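{- Let $\lambda$ be a partition and $\pi$ a reverse plane partition of shape $\lambda$. Then there exists a unique sequence $h_1,h_2,\dots,h_s$ ($s\ge0$) of rim-hooks of $\lambda$ such that $h_i\le h_{i+1}$ for all $i\in\{1,\dots,s-1\}$ (in the reverse lexicographic order on rim-hooks) and $h_1*h_2*\dots*h_s*0=\pi$, where $0$ is the zero reverse plane partition of shape $\lambda$ and each insertion is defined.
   Context: Cells are pairs $u=(u_1,u_2)\in\mathbb{Z}^2$ (row, column). Neighbours: $\mathrm{n}u=(u_1-1,u_2)$, $\mathrm{e}u=(u_1,u_2+1)$, $\mathrm{s}u=(u_1+1,u_2)$, $\mathrm{w}u=(u_1,u_2-1)$. The content of $u$ is $c(u)=u_2-u_1$. A partition $\lambda_1\ge\dots\ge\lambda_r>0$ is identified with its Young diagram $\lambda=\{(i,j):1\le i\le r,\ 1\le j\le\lambda_i\}$; $\lambda'$ is the conjugate partition. A reverse plane partition of shape $\lambda$ is a map $\pi:\lambda\to\mathbb{N}=\{0,1,2,\dots\}$ with $\pi(u)\le\pi(\mathrm{e}u)$ and $\pi(u)\le\pi(\mathrm{s}u)$ whenever these cells lie in $\lambda$; by convention $\pi(u)=0$ if $u_1\le0$ or $u_2\le0$, and $\pi(u)=\infty$ if $u_1,u_2\ge1$ but $u\notin\lambda$. A North-East-path in $\lambda$ is a sequence $P=(u_0,\dots,u_s)$ of cells of $\lambda$ with $u_k\in\{\mathrm{n}u_{k-1},\mathrm{e}u_{k-1}\}$ for $k=1,\dots,s$; its length is $\ell(P)=s$, head $\alpha(P)=u_0$,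 tail $\omega(P)=u_s$. A rim-hook of $\lambda$ is a North-East-path $h$ in $\lambda$ with $\mathrm{s}\alpha(h)\notin\lambda$, $\mathrm{e}\omega(h)\notin\lambda$, and $\mathrm{e}\mathrm{s}u\notin\lambda$ for all $u\in h$. For each cell $(i,j)\in\lambda$ there is a unique rim-hook with $\alpha(h)=(\lambda'_j,j)$ and $\omega(h)=(i,\lambda_i)$, giving a bijection between cells and rim-hooks. The reverse lexicographic order on cells is: $u\le v$ iff $u_2>v_2$, or $u_2=v_2$ and $u_1\ge v_1$; it is transferred to rim-hooks via this bijection. Equivalently, $f\le h$ iff $c(\alpha(f))>c(\alpha(h))$, or $c(\alpha(f))=c(\alpha(h))$ and $c(\omega(f))\le c(\omega(h))$. A cell $u\in\lambda$ is an outer corner if $\mathrm{e}u,\mathrm{s}u\notin\lambda$, and an inner corner if $\mathrm{e}u,\mathrm{s}u\in\lambda$ but $\mathrm{e}\mathrm{s}u\notin\lambda$. Let $i_1,\dots,i_r$ be the contents of the inner corners and $o_1,\dots,o_{r+1}$ those of the outer corners, ordered so that $o_1<i_1<o_2<\dots<o_r<i_r<o_{r+1}$. Define $\mathcal{I}=\{u\in\lambda:c(u)=i_k\text{ for some }k\}$, $\mathcal{O}=\{u\in\lambda:c(u)=o_k\text{ for some }k\}$, $\mathcal{A}=\{u\in\lambda:c(u)<o_1\text{ or }i_k<c(u)<o_{k+1}\text{ for some }k\in[r]\}$, $\mathcal{B}=\{u\in\lambda:o_k<c(u)<i_k\text{ for some }k\in[r]\text{ or }c(u)>o_{r+1}\}$.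 For a reverse plane partition $\pi$ and a path $P$ in $\lambda$, $\pi\pm P:\lambda\to\mathbb{Z}$ is given by $(\pi\pm P)(u)=\pi(u)\pm1$ if $u\in P$ and $\pi(u)$ otherwise. $P$ is $\pi$-compatible if (1) whenever $u\in P$ and $u\in\mathcal{I}\cup\mathcal{A}$, then $\mathrm{e}u\in P$ and $\pi(\mathrm{e}u)=\pi(u)$; and (2) whenever $u,\mathrm{n}u\in P$, then $\pi(\mathrm{n}u)=\pi(u)$. A rim-hook $h$ inserts into $\pi$ if there is a $\pi$-compatible North-East-path $P$ in $\lambda$ with $\omega(P)=\omega(h)$, $\ell(P)=\ell(h)$ and $\pi+P$ a reverse plane partition; such $P$ is unique, and one defines $h*\pi=\pi+P$. The expression $h_1*h_2*\dots*h_s*0$ means $h_1*(h_2*(\dots*(h_s*0)))$. -}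

module Defs where

open import Data.Nat using (ℕ; zero; suc; _+_; _∸_; _≤_; _<_; _≥_)
open import Data.Integer as ℤ using (ℤ; +_)
open import Data.Product using (Σ; ∃; _×_; _,_; proj₁; proj₂)
open import Data.Product.Properties using (≡-dec)
import Data.Nat.Properties as ℕP
open import Data.Sum using (_⊎_)
open import Data.List using (List; []; _∷_; length)
open import Data.List.Relation.Unary.All using (All)
open import Data.List.Relation.Unary.Linked using (Linked)
open import Data.List.Membership.Propositional using (_∈_)
import Data.List.Membership.DecPropositional as DecMem
open import Relation.Nullary using (¬_; does)
open import Relation.Binary.PropositionalEquality using (_≡_)
open import Data.Bool using (if_then_else_)

Cell : Set
Cell = ℕ × ℕ          -- (row , column), rows/columns of a diagram start at 1

n_ e_ s_ w_ : Cell → Cell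
n (i , j) = (i ∸ 1 , j)
e (i , j) = (i , suc j)
s (i , j) = (suc i , j)
w (i , j) = (i , j ∸ 1)

content : Cell → ℤ
content (i , j) = (+ j) ℤ.- (+ i)

IsPartition : List ℕ → Set
IsPartition la = Linked _≥_ la × All (λ x → 0 < x) la

-- rowLen la i = λ_i  (0 for i = 0 or i > r)
rowLen : List ℕ → ℕ → ℕ
rowLen []       _             = 0
rowLen (x ∷ xs) zero          = 0
rowLen (x ∷ xs) (suc zero)    = x
rowLen (x ∷ xs) (suc (suc i)) = rowLen xs (suc i)

-- (i , j) ∈ λ  iff  1 ≤ i ≤ r and 1 ≤ j ≤ λ_i
InShape : List ℕ → Cell → Set
InShape la (i , j) = 1 ≤ j × j ≤ rowLen la i

-- Reverse plane partitions (values outside λ are irrelevant)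

Filling : Set
Filling = Cell → ℕ

IsRPP : List ℕ → Filling → Set
IsRPP la π = ∀ u → InShape la u →
  (InShape la (e u) → π u ≤ π (e u)) × (InShape la (s u) → π u ≤ π (s u))

_≈[_]_ : Filling → List ℕ → Filling → Set
π ≈[ la ] σ = ∀ u → InShape la u → π u ≡ σ u

zeroRPP : Filling
zeroRPP _ = 0

NEStep : Cell → Cell → Set
NEStep u v = (v ≡ n u) ⊎ (v ≡ e u)

data IsNEPath (la : List ℕ) : List Cell → Set where
  single : ∀ {u} → InShape la u → IsNEPath la (u ∷ [])
  step   : ∀ {u v P} → InShape la u → NEStep u v → IsNEPath la (v ∷ P) →
           IsNEPath la (u ∷ v ∷ P)

ℓ : List Cell → ℕ
ℓ P = length P ∸ 1

-- head α(P) = u₀ (dummy value on the empty list, never a path)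
α : List Cell → Cell
α []      = (0 , 0)
α (u ∷ _) = u

ω : List Cell → Cell
ω []          = (0 , 0)
ω (u ∷ [])    = u
ω (_ ∷ v ∷ P) = ω (v ∷ P)

IsRimHook : List ℕ → List Cell → Set
IsRimHook la h = IsNEPath la h × ¬ InShape la (s (α h)) × ¬ InShape la (e (ω h))
               × (∀ u → u ∈ h → ¬ InShape la (e (s u)))

_≤rl_ : Cell → Cell → Set
u ≤rl v = (proj₂ v < proj₂ u) ⊎ (proj₂ u ≡ proj₂ v × proj₁ v ≤ proj₁ u)

-- the cell (i , j) corresponding to a rim-hook h, where α(h) = (λ'_j , j), ω(h) = (i , λ_i)
hookCell : List Cell → Cell
hookCell h = (proj₁ (ω h) , proj₂ (α h))

_≤hook_ : List Cell → List Cell → Set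
f ≤hook h = hookCell f ≤rl hookCell h

OuterCorner : List ℕ → Cell → Set
OuterCorner la u = InShape la u × ¬ InShape la (e u) × ¬ InShape la (s u)

InnerCorner : List ℕ → Cell → Set
InnerCorner la u = InShape la u × InShape la (e u) × InShape la (s u) × ¬ InShape la (e (s u))

OuterContent InnerContent : List ℕ → ℤ → Set
OuterContent la d = ∃ λ u → OuterCorner la u × content u ≡ d
InnerContent la d = ∃ λ u → InnerCorner la u × content u ≡ d

InI : List ℕ → Cell → Set
InI la u = InShape la u × InnerContent la (content u)

-- u ∈ 𝓐 : c(u) < o₁, or i_k < c(u) < o_{k+1} for some k.
-- "i_k and o_{k+1} are consecutive" is expressed as: i is an inner-corner content,
-- o an outer-corner content, and no corner content lies strictly between them.
InA : List ℕ → Cell → Set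
InA la u = InShape la u ×
  ( (∀ o → OuterContent la o → content u ℤ.< o)
  ⊎ (∃ λ i → ∃ λ o → InnerContent la i × OuterContent la o
       × i ℤ.< content u × content u ℤ.< o
       × (∀ d → (OuterContent la d ⊎ InnerContent la d) → ¬ (i ℤ.< d × d ℤ.< o))))

_≟c_ = ≡-dec ℕP._≟_ ℕP._≟_
open DecMem _≟c_ using (_∈?_)

_+P_ : Filling → List Cell → Filling
(π +P P) u = if does (u ∈? P) then suc (π u) else π u

Compatible : List ℕ → Filling → List Cell → Set
Compatible la π P =
  (∀ u → u ∈ P → (InI la u ⊎ InA la u) → e u ∈ P × π (e u) ≡ π u)
  × (∀ u → u ∈ P → n u ∈ P → π (n u) ≡ π u)

-- Inserts la h π σ : the rim-hook h inserts into π and h * π = σ (on the cells of λ)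
Inserts : List ℕ → List Cell → Filling → Filling → Set
Inserts la h π σ = ∃ λ P → IsNEPath la P × Compatible la π P × ω P ≡ ω h
  × ℓ P ≡ ℓ h × IsRPP la (π +P P) × σ ≈[ la ] (π +P P)

-- InsertsTo la [h₁,…,h_s] σ : all insertions in h₁ * (h₂ * (… * (h_s * 0))) are
-- defined and the result equals σ (on the cells of λ)
InsertsTo : List ℕ → List (List Cell) → Filling → Set
InsertsTo la []       σ = σ ≈[ la ] zeroRPP
InsertsTo la (h ∷ hs) σ = ∃ λ τ → InsertsTo la hs τ × Inserts la h τ σ

GoodSeq : List ℕ → Filling → List (List Cell) → Set
GoodSeq la π hs = All (IsRimHook la) hs × Linked _≤hook_ hs × InsertsTo la hs π

{-# OPTIONS --safe #-}

-- The insertions are undone one at a time.  Call a diagonal East if the rim continues eastward from it (these are the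
-- diagonals of 𝓘 ∪ 𝓐) and North otherwise.  A candidate of π is a cell u with π(u) > π(w u) such that w u lies on an East
-- diagonal.  The last inserted path starts in the candidate of largest content that is furthest south-east, and from
-- there it is forced by π: on East diagonals it goes east; on North diagonals it goes north if π(n u) = π(u), otherwise
-- east, and it stops when it would leave λ.  That the hooks come in increasing order matches this choice of candidate
-- because paths of successive insertions starting on the same diagonal do not cross.
module Submission where

open import Defs
open import Data.Nat using (ℕ; zero; suc; pred; _+_; _≤_; _<_; _≥_; z≤n; s≤s; _≤?_; _<?_)
import Data.Nat.Properties as ℕₚ
open import Data.Integer as ℤ using (ℤ; _⊖_)
import Data.Integer.Properties as ℤₚ
open import Data.List using (List; []; _∷_; length; map; filter; upTo; cartesianProduct)
open import Data.Nat.ListAction using (sum)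
open import Data.List.Relation.Unary.All using (All; []; _∷_)
open import Data.List.Relation.Unary.Any using (here; there)
open import Data.List.Relation.Unary.Linked using (Linked; []; [-]; _∷_)
open import Data.List.Membership.Propositional using (_∈_; _∉_)
open import Data.List.Membership.Propositional.Properties using (∈-filter⁺; ∈-cartesianProduct⁺; ∈-upTo⁺)
open import Data.List.Relation.Unary.All.Properties using (all-filter)
import Data.List.Membership.DecPropositional as DecMembership
open import Data.Product using (Σ; ∃; _×_; _,_; proj₁; proj₂)
open import Data.Sum using (_⊎_; inj₁; inj₂; map₁)
open import Data.Empty using (⊥; ⊥-elim)
open import Function using (id; case_of_)
open import Data.Bool using (if_then_else_)
open import Relation.Nullary using (¬_; Dec; yes; no; does)
open import Relation.Nullary.Decidable using (_×-dec_)
open import Relation.Binary using (tri<; tri≈; tri>)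
open import Relation.Binary.PropositionalEquality using (_≡_; _≢_; refl; sym; trans; cong; cong₂; subst; subst₂)

open DecMembership _≟c_ using (_∈?_)

-- The start of the last path can be read off from the filling because a path through a cell `w v`
-- on an East diagonal must continue to `v`, and can reach `v` only from `w v` or by starting there.
-- Adding or removing a path thus changes the entries of `v` and `w v` together unless `v` is its
-- start, so candidates beyond the start are neither created nor destroyed. The obstacle is a tie:
-- for hooks starting on the same diagonal the order compares the ends, whereas candidates compare
-- the starts. Non-crossing translates between the two, and is needed twice: uniqueness knows the
-- order of the hooks and needs the position of the starts, existence knows the starts and needs the
-- order. In each case two walks are followed diagonal by diagonal, one in the larger and one in the
-- smaller filling.

-- Contents and diagonals

row col : Cell → ℕ
row = proj₁
col = proj₂

-- Comparing contents means comparing differences of naturals; adding both rows to both sides removes the subtraction.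
private
  content-shift : ∀ k u → content u ≡ (k + col u) ⊖ (k + row u)
  content-shift k (i , j) = trans (ℤₚ.m-n≡m⊖n j i) (sym (ℤₚ.+-cancelˡ-⊖ k j i))

  content-shiftˡ : ∀ u v → content u ≡ (col u + row v) ⊖ (row u + row v)
  content-shiftˡ u v = trans (content-shift (row v) u)
    (cong₂ _⊖_ (ℕₚ.+-comm (row v) (col u)) (ℕₚ.+-comm (row v) (row u)))

  content-shiftʳ : ∀ u v → content v ≡ (col v + row u) ⊖ (row u + row v)
  content-shiftʳ u v = trans (content-shift (row u) v) (cong (_⊖ (row u + row v)) (ℕₚ.+-comm (row u) (col v)))

content-≤⁺ : ∀ u v → col u + row v ≤ col v + row u → content u ℤ.≤ content v
content-≤⁺ u v le = subst₂ ℤ._≤_ (sym (content-shiftˡ u v)) (sym (content-shiftʳ u v))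
  (ℤₚ.⊖-monoˡ-≤ (row u + row v) le)

content-<⁺ : ∀ u v → col u + row v < col v + row u → content u ℤ.< content v
content-<⁺ u v lt = subst₂ ℤ._<_ (sym (content-shiftˡ u v)) (sym (content-shiftʳ u v))
  (ℤₚ.⊖-monoˡ-< (row u + row v) lt)

content-≡⁺ : ∀ u v → col u + row v ≡ col v + row u → content u ≡ content v
content-≡⁺ u v eq = trans (content-shiftˡ u v)
  (trans (cong (_⊖ (row u + row v)) eq) (sym (content-shiftʳ u v)))

content-≡⁻ : ∀ u v → content u ≡ content v → col u + row v ≡ col v + row u
content-≡⁻ u v eq with ℕₚ.<-cmp (col u + row v) (col v + row u)
... | tri< lt _ _ = ⊥-elim (ℤₚ.<-irrefl eq (content-<⁺ u v lt))
... | tri≈ _ e≡ _ = e≡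
... | tri> _ _ gt = ⊥-elim (ℤₚ.<-irrefl (sym eq) (content-<⁺ v u gt))

content-<⁻ : ∀ u v → content u ℤ.< content v → col u + row v < col v + row u
content-<⁻ u v lt with (col u + row v) <? (col v + row u)
... | yes p = p
... | no ¬p = ⊥-elim (ℤₚ.<⇒≱ lt (content-≤⁺ v u (ℕₚ.≮⇒≥ ¬p)))

content-e : ∀ u → content (e u) ≡ ℤ.suc (content u)
content-e (i , j) = ℤₚ.+-assoc (ℤ.+ 1) (ℤ.+ j) (ℤ.- (ℤ.+ i))

content-n : ∀ u → 1 ≤ row u → content (n u) ≡ ℤ.suc (content u)
content-n (suc i , j) _ = trans (content-≡⁺ (i , j) (suc i , suc j) (ℕₚ.+-suc j i)) (content-e (suc i , j))

content-w : ∀ u → 1 ≤ col u → content u ≡ ℤ.suc (content (w u))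
content-w (i , suc j) _ = content-e (i , j)

content-es : ∀ u → content (e (s u)) ≡ content u
content-es (i , j) = content-≡⁺ (suc i , suc j) (i , j) (sym (ℕₚ.+-suc j i))

i<suc-i : ∀ i → i ℤ.< ℤ.suc i
i<suc-i i = ℤₚ.suc[i]≤j⇒i<j ℤₚ.≤-refl

record _↘_ (u v : Cell) : Set where
  constructor nw
  field
    diag : content u ≡ content v
    rows : row u ≤ row v

open _↘_

↘-refl : ∀ {u} → u ↘ u
↘-refl = nw refl ℕₚ.≤-refl

↘-trans : ∀ {u v x} → u ↘ v → v ↘ x → u ↘ x
↘-trans (nw p q) (nw p′ q′) = nw (trans p p′) (ℕₚ.≤-trans q q′)

↘-col : ∀ {u v} → u ↘ v → col u ≤ col v
↘-col {u} {v} (nw p q) = ℕₚ.+-cancelʳ-≤ (row u) (col u) (col v)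
  (ℕₚ.≤-trans (ℕₚ.+-monoʳ-≤ (col u) q) (ℕₚ.≤-reflexive (content-≡⁻ u v p)))

↘-es : ∀ u → u ↘ (e (s u))
↘-es u = nw (sym (content-es u)) (ℕₚ.n≤1+n _)

↘-strict : ∀ {u v} → content u ≡ content v → row u < row v → (e (s u)) ↘ v
↘-strict {u} eq lt = nw (trans (content-es u) eq) lt

diag-row-injective : ∀ {u v} → content u ≡ content v → row u ≡ row v → u ≡ v
diag-row-injective {i , j} {.i , j′} eq refl = cong (i ,_) (ℕₚ.+-cancelʳ-≡ i j j′ (content-≡⁻ (i , j) (i , j′) eq))

ℤ-suc-injective : ∀ {i j} → ℤ.suc i ≡ ℤ.suc j → i ≡ j
ℤ-suc-injective {i} {j} eq = trans (sym (ℤₚ.pred-suc i)) (trans (cong ℤ.pred eq) (ℤₚ.pred-suc j))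

↘-e : ∀ {u v} → u ↘ v → (e u) ↘ (e v)
↘-e {u} {v} (nw p q) = nw (trans (content-e u) (trans (cong ℤ.suc p) (sym (content-e v)))) q

-- The diagram of a partition

rowLen-antitone : ∀ {la} → Linked _≥_ la → ∀ {i k} → 1 ≤ i → i ≤ k → rowLen la k ≤ rowLen la i
rowLen-antitone {[]} _ _ _ = z≤n
rowLen-antitone {x ∷ xs} L {suc zero} {suc zero} _ _ = ℕₚ.≤-refl
rowLen-antitone {x ∷ []} L {suc zero} {suc (suc k)} _ _ = z≤n
rowLen-antitone {x ∷ y ∷ xs} (p ∷ L) {suc zero} {suc (suc k)} _ _ =
  ℕₚ.≤-trans (rowLen-antitone L {1} {suc k} (s≤s z≤n) (s≤s z≤n)) p
rowLen-antitone {x ∷ []} L {suc (suc i)} {suc (suc k)} _ _ = z≤n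
rowLen-antitone {x ∷ []} L {suc (suc i)} {suc zero} _ (s≤s ())
rowLen-antitone {x ∷ y ∷ xs} (p ∷ L) {suc (suc i)} {suc (suc k)} _ (s≤s le) =
  rowLen-antitone L (s≤s z≤n) le

rowLen-length : ∀ la {i} → 1 ≤ rowLen la i → 1 ≤ i × i ≤ length la
rowLen-length (x ∷ xs) {suc zero} _ = s≤s z≤n , s≤s z≤n
rowLen-length (x ∷ xs) {suc (suc i)} p = s≤s z≤n , s≤s (proj₂ (rowLen-length xs p))

module _ (la : List ℕ) (part : IsPartition la) where

  In : Cell → Set
  In = InShape la

  In? : ∀ u → Dec (In u)
  In? (i , j) = (1 ≤? j) ×-dec (j ≤? rowLen la i)

  In-row : ∀ {u} → In u → 1 ≤ row u
  In-row (p , q) = proj₁ (rowLen-length la (ℕₚ.≤-trans p q))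

  In-mono : ∀ {u v} → In v → 1 ≤ row u → 1 ≤ col u → row u ≤ row v → col u ≤ col v → In u
  In-mono (_ , q) ri ci r≤ c≤ = ci , ℕₚ.≤-trans c≤ (ℕₚ.≤-trans q (rowLen-antitone (proj₁ part) ri r≤))

  In-↘ : ∀ {u v} → In v → 1 ≤ row u → 1 ≤ col u → u ↘ v → In u
  In-↘ iv ri ci p = In-mono iv ri ci (rows p) (↘-col p)

  -- East and North diagonals, and the regions between corners

  -- East u (North u): the rim leaves the rim cell on the diagonal of u by an east (north) step, so that the
  -- diagonals of 𝓘 ∪ 𝓐 are the East ones.  East also makes sense for the column 0, just outside of the diagram.
  East North : Cell → Set
  East u  = ∃ λ v → u ↘ v × In (e v) × ¬ In (e (s v))
  North u = ∃ λ v → u ↘ v × In v × ¬ In (e v)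

  East-North : ∀ {u} → East u → North u → ⊥
  East-North (v , u↘v , iev , ¬iesv) (x , u↘x , ix , ¬iex) with row x ≤? row v
  ... | yes p = ¬iex (In-↘ iev (In-row ix) (s≤s z≤n) (↘-e (nw (trans (sym (diag u↘x)) (diag u↘v)) p)))
  ... | no ¬p = ¬iesv (In-↘ ix (s≤s z≤n) (s≤s z≤n)
                  (↘-strict (trans (sym (diag u↘v)) (diag u↘x)) (ℕₚ.≰⇒> ¬p)))

  -- The hypothesis is `In (e x)` and not `In x` because `x` may lie in column 0. If `x` were below
  -- the rim cell `v`, then `e x` would force `e (s v)` into the diagram.
  East-diag : ∀ {u x} → content u ≡ content x → In (e x) → East u → East x
  East-diag {u} {x} eq iex (v , u↘v , iev , ¬iesv) with row x ≤? row v
  ... | yes p = v , nw (trans (sym eq) (diag u↘v)) p , iev , ¬iesv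
  ... | no ¬p = ⊥-elim (¬iesv (In-mono iex (s≤s z≤n) (s≤s z≤n) (rows esv↘x)
                  (ℕₚ.≤-trans (↘-col esv↘x) (ℕₚ.n≤1+n _))))
    where
    esv↘x : (e (s v)) ↘ x
    esv↘x = ↘-strict (trans (sym (diag u↘v)) eq) (ℕₚ.≰⇒> ¬p)

  North-diag : ∀ {u x} → content u ≡ content x → In x → North u → North x
  North-diag {u} {x} eq ix (v , u↘v , iv , ¬iev) with row x ≤? row v
  ... | yes p = v , nw (trans (sym eq) (diag u↘v)) p , iv , ¬iev
  ... | no ¬p = ⊥-elim (¬iev (In-mono ix (In-row iv) (s≤s z≤n)
                  (ℕₚ.≤-trans (ℕₚ.n≤1+n _) (rows esv↘x)) (↘-col esv↘x)))
    where
    esv↘x : (e (s v)) ↘ x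
    esv↘x = ↘-strict (trans (sym (diag u↘v)) eq) (ℕₚ.≰⇒> ¬p)

  East-↘ : ∀ {u v} → u ↘ v → East v → East u
  East-↘ u↘v (x , v↘x , r) = x , ↘-trans u↘v v↘x , r

  North-↘ : ∀ {u v} → u ↘ v → North v → North u
  North-↘ u↘v (x , v↘x , r) = x , ↘-trans u↘v v↘x , r

  private
    -- Descends the diagonal to the rim; `k` bounds the number of steps, as each one moves a column
    -- to the right.
    East⊎North′ : ∀ k u → rowLen la 1 ≤ k + col u → In u → East u ⊎ North u
    East⊎North′ k u le iu with In? (e u)
    East⊎North′ k u le iu | no ¬p = inj₂ (u , ↘-refl , iu , ¬p)
    East⊎North′ zero u le iu | yes (_ , p) = ⊥-elim (ℕₚ.<⇒≱
      (ℕₚ.≤-trans p (rowLen-antitone (proj₁ part) ℕₚ.≤-refl (In-row iu))) le)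
    East⊎North′ (suc k) u le iu | yes p with In? (e (s u))
    ... | no ¬q = inj₁ (u , ↘-refl , p , ¬q)
    ... | yes q with East⊎North′ k (e (s u)) (ℕₚ.≤-trans le (ℕₚ.≤-reflexive (sym (ℕₚ.+-suc k (col u))))) q
    ...   | inj₁ E = inj₁ (East-↘ (↘-es u) E)
    ...   | inj₂ N = inj₂ (North-↘ (↘-es u) N)

  East⊎North : ∀ {u} → In u → East u ⊎ North u
  East⊎North {u} = East⊎North′ (rowLen la 1) u (ℕₚ.m≤m+n _ _)

  -- `w u` may lie outside the diagram, where `East⊎North` says nothing; `s u` is the next cell on
  -- its diagonal and takes over when it is inside.
  East-w? : ∀ {u} → In u → Dec (East (w u))
  East-w? {i , suc j} iu with In? (suc i , suc j)
  ... | no ¬p = yes ((i , j) , ↘-refl , iu , ¬p)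
  ... | yes p with East⊎North p
  ...   | inj₁ E = yes (East-↘ (↘-es (i , j)) E)
  ...   | inj₂ N = no (λ E → East-North E (North-↘ (↘-es (i , j)) N))

  East⇒IA : ∀ {u} → In u → East u → InI la u ⊎ InA la u
  East⇒IA {u} iu (v@(i , j) , u↘v , iev , ¬iesv) with In? (s v)
  ... | yes isv = inj₁ (iu , v , (In-mono iev (In-row iev) (ℕₚ.≤-trans (proj₁ iu) (↘-col u↘v)) ℕₚ.≤-refl (ℕₚ.n≤1+n j)
                                 , iev , isv , ¬iesv) , sym (diag u↘v))
  ... | no ¬isv = inj₂ (iu , bottom-row (rowLen la (suc i)) refl)
    where
    -- If row `i` is the last one, `v` precedes every outer corner. Otherwise `v` lies strictly
    -- between the inner corner above the end of row `i + 1` and the outer corner ending row `i`.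
    bottom-row : ∀ m → rowLen la (suc i) ≡ m → _
    bottom-row zero eq = inj₁ λ { _ (y@(i′ , j′) , (iy , ¬iey , _) , refl) →
      let i′≤i = ℕₚ.≮⇒≥ λ lt → ℕₚ.<⇒≱ (s≤s z≤n) (ℕₚ.≤-trans (proj₂ (In-mono {suc i , 1} iy (s≤s z≤n) (s≤s z≤n) lt (proj₁ iy)))
                                                   (ℕₚ.≤-reflexive eq))
          j<j′ = ℕₚ.≰⇒> λ le → ¬iey (In-mono iev (In-row iy) (s≤s z≤n) i′≤i (s≤s le))
      in subst (ℤ._< content y) (sym (diag u↘v)) (content-<⁺ v y (ℕₚ.+-mono-<-≤ j<j′ i′≤i)) }
    bottom-row (suc m) eq = inj₂
      ( content x , content y
      , (x , ( In-mono iex (In-row iev) (s≤s z≤n) ℕₚ.≤-refl (ℕₚ.n≤1+n _) , iex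
             , (s≤s z≤n , ℕₚ.≤-reflexive (sym eq))
             , λ p → ℕₚ.<⇒≱ (proj₂ p) (ℕₚ.≤-reflexive eq)) , refl)
      , (y , (iy , (λ p → ℕₚ.<⇒≱ (proj₂ p) ℕₚ.≤-refl)
                 , λ p → ¬isvL (proj₂ p)) , refl)
      , subst (content x ℤ.<_) (sym (diag u↘v)) (content-<⁺ x v (ℕₚ.+-monoˡ-< i sm<j))
      , subst (ℤ._< content y) (sym (diag u↘v)) (content-<⁺ v y (ℕₚ.+-monoˡ-< i (proj₂ iev)))
      , λ { d (inj₁ (z , (iz , ¬iez , ¬isz) , refl)) (x<z , z<y) →
              ¬iez (proj₁ (in-row z iz (λ p → ¬iez (In-mono p (In-row iz) (s≤s z≤n) (ℕₚ.n≤1+n _) ℕₚ.≤-refl)) x<z z<y))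
          ; d (inj₂ (z , (iz , iez , isz , ¬iesz) , refl)) (x<z , z<y) →
              proj₂ (in-row z iz ¬iesz x<z z<y) isz } )
      where
      sm<j : suc m < j
      sm<j = ℕₚ.≰⇒> λ le → ¬isv (ℕₚ.≤-trans (proj₁ iu) (↘-col u↘v) , ℕₚ.≤-trans le (ℕₚ.≤-reflexive (sym eq)))
      x y : Cell
      x = i , suc m
      y = i , rowLen la i
      iex : In (e x)
      iex = In-mono iev (In-row iev) (s≤s z≤n) ℕₚ.≤-refl (ℕₚ.≤-trans sm<j (ℕₚ.n≤1+n j))
      iy : In y
      iy = ℕₚ.≤-trans (s≤s z≤n) (proj₂ iev) , ℕₚ.≤-refl
      ¬isvL : ¬ (rowLen la i ≤ rowLen la (suc i))
      ¬isvL le = ℕₚ.<⇒≱ (ℕₚ.≤-trans sm<j (ℕₚ.≤-trans (ℕₚ.n≤1+n j) (proj₂ iev))) (ℕₚ.≤-trans le (ℕₚ.≤-reflexive eq))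
      -- Between the contents of `x` and `y` the rim stays in row `i`, so its cells there are
      -- corners of neither kind.
      in-row : ∀ z → In z → ¬ In (e (s z)) → content x ℤ.< content z → content z ℤ.< content y → In (e z) × ¬ In (s z)
      in-row z@(p , q) iz ¬iesz x<z z<y with ℕₚ.<-cmp p i
      ... | tri< p<i _ _ = ⊥-elim (¬iesz (In-mono iy (s≤s z≤n) (s≤s z≤n) p<i
              (ℕₚ.+-cancelʳ-< p q _ (ℕₚ.<-trans (ℕₚ.+-monoʳ-< q p<i) (content-<⁻ z y z<y)))))
      ... | tri≈ _ refl _ = (s≤s z≤n , ℕₚ.+-cancelʳ-< i q _ (content-<⁻ z y z<y))
              , λ isz → ℕₚ.<⇒≱ (ℕₚ.+-cancelʳ-< i _ q (content-<⁻ x z x<z)) (ℕₚ.≤-trans (proj₂ isz) (ℕₚ.≤-reflexive eq))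
      ... | tri> _ _ i<p = ⊥-elim (ℕₚ.<⇒≱
              (ℕₚ.+-cancelʳ-< i _ q (ℕₚ.<-trans (ℕₚ.+-monoʳ-< (suc m) i<p) (content-<⁻ x z x<z)))
              (ℕₚ.≤-trans (proj₂ (In-mono {suc i , q} iz (s≤s z≤n) (proj₁ iz) i<p ℕₚ.≤-refl)) (ℕₚ.≤-reflexive eq)))

  outer-corner-below : ∀ k v → length la ≤ k + row v → In v → ¬ In (e v) →
    ∃ λ y → OuterCorner la y × col y ≡ col v × row v ≤ row y
  outer-corner-below k v le iv ¬iev with In? (s v)
  outer-corner-below k v le iv ¬iev | no ¬isv = v , (iv , ¬iev , ¬isv) , refl , ℕₚ.≤-refl
  outer-corner-below zero v le iv ¬iev | yes isv =
    ⊥-elim (ℕₚ.<⇒≱ (proj₂ (rowLen-length la (ℕₚ.≤-trans (proj₁ isv) (proj₂ isv)))) le)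
  outer-corner-below (suc k) v le iv ¬iev | yes isv
    with outer-corner-below k (s v) (ℕₚ.≤-trans le (ℕₚ.≤-reflexive (sym (ℕₚ.+-suc k (row v))))) isv
           (λ p → ¬iev (In-mono p (In-row iv) (s≤s z≤n) (ℕₚ.n≤1+n _) ℕₚ.≤-refl))
  ... | y , oy , c , r = y , oy , c , ℕₚ.<⇒≤ r

  IA⇒¬North : ∀ {u} → InI la u ⊎ InA la u → ¬ North u
  IA⇒¬North (inj₁ (_ , x , (ix , iex , _ , ¬iesx) , eq)) N =
    East-North (x , ↘-refl , iex , ¬iesx) (North-diag (sym eq) ix N)
  IA⇒¬North {u} (inj₂ (_ , A)) (v , u↘v , iv , ¬iev)
    with outer-corner-below (length la) v (ℕₚ.m≤m+n _ _) iv ¬iev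
  ... | y , oy@(iy , ¬iey , _) , refl , r≤ = excluded A
    where
    y≤u : content y ℤ.≤ content u
    y≤u = ℤₚ.≤-trans (content-≤⁺ y v (ℕₚ.+-monoʳ-≤ (col v) r≤)) (ℤₚ.≤-reflexive (sym (diag u↘v)))
    excluded : _ → ⊥
    excluded (inj₁ c<) = ℤₚ.<⇒≱ (c< (content y) (y , oy , refl)) y≤u
    -- The outer corner `y` at the foot of the column of `v` cannot lie strictly between `x` and
    -- `o`, so its content is at most that of `x`. To the left of `v`, `x` would then have `e (s x)`
    -- inside; otherwise it lies below `v`, and `e x` forces `e v` inside.
    excluded (inj₂ (_ , o , (x , (ix , iex , _ , ¬iesx) , refl) , _ , x<u , u<o , between))
      with col x <? col v
    ... | yes q<b = ¬iesx (In-mono iy (s≤s z≤n) (s≤s z≤n) p<a′ q<b)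
      where
      y≤x : content y ℤ.≤ content x
      y≤x = ℤₚ.≮⇒≥ λ x<y → between (content y) (inj₁ (y , oy , refl)) (x<y , ℤₚ.≤-<-trans y≤u u<o)
      p<a′ : row x < row y
      p<a′ = ℕₚ.≰⇒> λ a′≤p → ℤₚ.<⇒≱ (content-<⁺ x y (ℕₚ.+-mono-<-≤ q<b a′≤p)) y≤x
    ... | no b≤q = ¬iev (In-mono iex (In-row iv) (s≤s z≤n) (ℕₚ.<⇒≤ a<p) (s≤s (ℕₚ.≮⇒≥ b≤q)))
      where
      a<p : row v < row x
      a<p = ℕₚ.≰⇒> λ p≤a → ℤₚ.<⇒≱ (subst (content x ℤ.<_) (diag u↘v) x<u)
              (content-≤⁺ v x (ℕₚ.+-mono-≤ (ℕₚ.≮⇒≥ b≤q) p≤a))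

  -- North-East-paths

  step-content : ∀ {u v} → In u → NEStep u v → content v ≡ ℤ.suc (content u)
  step-content {u} iu (inj₁ refl) = content-n u (In-row iu)
  step-content {u} iu (inj₂ refl) = content-e u

  step-bounds : ∀ {u v} → NEStep u v → row v ≤ row u × col u ≤ col v
  step-bounds (inj₁ refl) = ℕₚ.m∸n≤m _ 1 , ℕₚ.≤-refl
  step-bounds (inj₂ refl) = ℕₚ.≤-refl , ℕₚ.n≤1+n _

  path-In : ∀ {u P v} → IsNEPath la (u ∷ P) → v ∈ u ∷ P → In v
  path-In (single iu) (here refl) = iu
  path-In (step iu _ _) (here refl) = iu
  path-In (step _ _ p) (there v∈) = path-In p v∈

  path-bounds : ∀ {u P v} → IsNEPath la (u ∷ P) → v ∈ u ∷ P → row v ≤ row u × col u ≤ col v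
  path-bounds _ (here refl) = ℕₚ.≤-refl , ℕₚ.≤-refl
  path-bounds (step _ st p) (there v∈) with path-bounds p v∈ | step-bounds st
  ... | r , c | r′ , c′ = ℕₚ.≤-trans r r′ , ℕₚ.≤-trans c′ c

  content-ω : ∀ {u P} → IsNEPath la (u ∷ P) → content (ω (u ∷ P)) ≡ ℤ.+ length P ℤ.+ content u
  content-ω (single _) = sym (ℤₚ.+-identityˡ _)
  content-ω {u} {v ∷ P} (step iu st p) = trans (content-ω p)
    (trans (cong (ℤ._+_ (ℤ.+ length P)) (step-content iu st))
    (trans (sym (ℤₚ.+-assoc (ℤ.+ length P) (ℤ.+ 1) (content u)))
           (cong (ℤ._+ content u) (ℤₚ.+-comm (ℤ.+ length P) (ℤ.+ 1)))))

  content≤content-ω : ∀ {u P} → IsNEPath la (u ∷ P) → content u ℤ.≤ content (ω (u ∷ P))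
  content≤content-ω {u} {P} p = ℤₚ.≤-trans (ℤₚ.i≤j+i (content u) (ℤ.+ length P)) (ℤₚ.≤-reflexive (sym (content-ω p)))

  step-< : ∀ {u v} → In u → NEStep u v → content u ℤ.< content v
  step-< {u} iu st = subst (content u ℤ.<_) (sym (step-content iu st)) (i<suc-i (content u))

  path-content-≤ : ∀ {u P v} → IsNEPath la (u ∷ P) → v ∈ u ∷ P → content u ℤ.≤ content v
  path-content-≤ _ (here refl) = ℤₚ.≤-refl
  path-content-≤ (step iu st p) (there v∈) = ℤₚ.≤-trans (ℤₚ.<⇒≤ (step-< iu st)) (path-content-≤ p v∈)

  n-not-below : ∀ {v} → In v → ¬ (row v ≤ row (n v))
  n-not-below {zero , _} iv _ = ℕₚ.<⇒≱ (In-row iv) z≤n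
  n-not-below {suc i , _} _ le = ℕₚ.<-irrefl refl le

  In-e-of-below : ∀ {v x} → In v → In x → content v ≡ content x → row v < row x → In (e v)
  In-e-of-below {v} {x} iv ix eq lt = In-mono ix (In-row iv) (s≤s z≤n) (ℕₚ.<⇒≤ lt) (↘-col esv↘x)
    where
    esv↘x : (e (s v)) ↘ x
    esv↘x = ↘-strict eq lt

  extend-split : ∀ {v v′ : Cell} {S L : List Cell} → NEStep v v′ →
    (∀ {x} → x ∈ L → x ∈ v ∷ v′ ∷ S ⊎ (row v ≤ row x × col x ≤ col v)) →
    ∀ {x} → x ∈ L → x ∈ v′ ∷ S ⊎ (row v′ ≤ row x × col x ≤ col v′)
  extend-split st split x∈ with split x∈
  ... | inj₁ (here refl) = inj₂ (step-bounds st)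
  ... | inj₁ (there p) = inj₁ p
  ... | inj₂ (r , c) = inj₂ (ℕₚ.≤-trans (proj₁ (step-bounds st)) r , ℕₚ.≤-trans c (proj₂ (step-bounds st)))

  path-head-above : ∀ {u P v} → IsNEPath la (u ∷ P) → v ∈ u ∷ P → n v ≢ u
  path-head-above {v = zero , _} p v∈ refl = ℕₚ.<⇒≱ (In-row (path-In p v∈)) z≤n
  path-head-above {v = suc i , _} p v∈ refl = ℕₚ.<-irrefl refl (proj₁ (path-bounds p v∈))

  wn-↘ : ∀ {u} → In u → (w (n u)) ↘ u
  wn-↘ {zero , _} iu = ⊥-elim (ℕₚ.<⇒≱ (In-row iu) z≤n)
  wn-↘ {suc i , suc j} _ = ↘-es (i , j)

  -- Reverse plane partitions and the walks of a removal

  -- Zero on all of the outside, even to the south-east where the usual convention is infinity;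
  -- monotonicity is therefore asked only into cells of the diagram.
  record Rpp (g : Filling) : Set where
    field
      outside : ∀ {u} → ¬ In u → g u ≡ 0
      mono-e  : ∀ {u} → In (e u) → g u ≤ g (e u)
      mono-s  : ∀ {u} → In (s u) → g u ≤ g (s u)

  rpp-n : ∀ {g v} → Rpp g → In v → g (n v) ≤ g v
  rpp-n {v = zero , _} r iv = ⊥-elim (ℕₚ.<⇒≱ (In-row iv) z≤n)
  rpp-n {v = suc i , j} r iv = Rpp.mono-s r iv

  rpp-w : ∀ {g v} → Rpp g → In v → g (w v) ≤ g v
  rpp-w {v = i , suc j} r iv = Rpp.mono-e r iv

  -- The steps of the path removed from g; the inequalities are those which make the difference a reverse plane partition.
  data Move (g : Filling) (u : Cell) : Cell → Set where
    north : North u → g (n u) ≡ g u → g (w (n u)) < g (n u) → Move g u (n u)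
    neast : North u → g (n u) < g u → Move g u (e u)
    east  : East u → g (n u) < g u → g (e u) ≡ g u → Move g u (e u)

  -- The list omits the head, so its length is `ℓ` of the path. No walk stops on an East diagonal,
  -- where compatibility demands the east neighbour. The inequality of `stop` is there because the
  -- last cell is lowered and its north neighbour is not.
  data Walk (g : Filling) : Cell → List Cell → Set where
    stop : ∀ {u} → In u → North u → ¬ In (e u) → g (n u) < g u → Walk g u []
    move : ∀ {u v P} → In u → Move g u v → Walk g v P → Walk g u (v ∷ P)

  module _ {g : Filling} where

    move-step : ∀ {u v} → Move g u v → NEStep u v
    move-step (north _ _ _) = inj₁ refl
    move-step (neast _ _) = inj₂ refl
    move-step (east _ _ _) = inj₂ refl

    walk-path : ∀ {u P} → Walk g u P → IsNEPath la (u ∷ P)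
    walk-path (stop iu _ _ _) = single iu
    walk-path (move iu m W) = step iu (move-step m) (walk-path W)

    walk-In : ∀ {u P} → Walk g u P → In u
    walk-In W = path-In (walk-path W) (here refl)

    move-deterministic : ∀ {u v x} → Move g u v → Move g u x → v ≡ x
    move-deterministic (north _ _ _) (north _ _ _) = refl
    move-deterministic (north _ eq _) (neast _ lt) = ⊥-elim (ℕₚ.<-irrefl eq lt)
    move-deterministic (north _ eq _) (east _ lt _) = ⊥-elim (ℕₚ.<-irrefl eq lt)
    move-deterministic (neast _ lt) (north _ eq _) = ⊥-elim (ℕₚ.<-irrefl eq lt)
    move-deterministic (east _ lt _) (north _ eq _) = ⊥-elim (ℕₚ.<-irrefl eq lt)
    move-deterministic (neast _ _) (neast _ _) = refl
    move-deterministic (neast _ _) (east _ _ _) = refl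
    move-deterministic (east _ _ _) (neast _ _) = refl
    move-deterministic (east _ _ _) (east _ _ _) = refl

    stop-move : ∀ {u v} → ¬ In (e u) → g (n u) < g u → In v → ¬ Move g u v
    stop-move _ lt _ (north _ eq _) = ℕₚ.<-irrefl eq lt
    stop-move ¬ie _ iv (neast _ _) = ¬ie iv
    stop-move ¬ie _ iv (east _ _ _) = ¬ie iv

    walk-deterministic : ∀ {u P Q} → Walk g u P → Walk g u Q → P ≡ Q
    walk-deterministic (stop _ _ _ _) (stop _ _ _ _) = refl
    walk-deterministic (stop _ _ ¬ie lt) (move _ m W) = ⊥-elim (stop-move ¬ie lt (walk-In W) m)
    walk-deterministic (move _ m W) (stop _ _ ¬ie lt) = ⊥-elim (stop-move ¬ie lt (walk-In W) m)
    walk-deterministic (move _ m W) (move _ m′ W′) with move-deterministic m m′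
    ... | refl = cong (_ ∷_) (walk-deterministic W W′)

    walk-positive : ∀ {u P v} → Walk g u P → v ∈ u ∷ P → 0 < g v
    walk-positive (stop _ _ _ lt) (here refl) = ℕₚ.≤-<-trans z≤n lt
    walk-positive (move _ (north _ eq _) W) (here refl) = subst (0 <_) eq (walk-positive W (here refl))
    walk-positive (move _ (neast _ lt) _) (here refl) = ℕₚ.≤-<-trans z≤n lt
    walk-positive (move _ (east _ lt _) _) (here refl) = ℕₚ.≤-<-trans z≤n lt
    walk-positive (move _ _ W) (there v∈) = walk-positive W v∈

    walk-north : ∀ {u P v} → Walk g u P → v ∈ u ∷ P → n v ∈ u ∷ P ⊎ g (n v) < g v
    walk-north (stop _ _ _ lt) (here refl) = inj₂ lt
    walk-north (move _ (north _ _ _) _) (here refl) = inj₁ (there (here refl))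
    walk-north (move _ (neast _ lt) _) (here refl) = inj₂ lt
    walk-north (move _ (east _ lt _) _) (here refl) = inj₂ lt
    walk-north (move _ _ W) (there v∈) = map₁ there (walk-north W v∈)

    -- A cell after the head is entered from the west or from below, and in the second case `north`
    -- carries the inequality. The head is left open: there a removal uses that it starts in a
    -- candidate.
    walk-west : ∀ {u P v} → Walk g u P → v ∈ u ∷ P → v ≡ u ⊎ w v ∈ u ∷ P ⊎ g (w v) < g v
    walk-west _ (here refl) = inj₁ refl
    walk-west (move _ m W) (there v∈) with walk-west W v∈
    ... | inj₂ r = inj₂ (map₁ there r)
    walk-west (move _ (north _ _ lt) _) (there v∈) | inj₁ refl = inj₂ (inj₂ lt)
    walk-west (move _ (neast _ _) _) (there v∈) | inj₁ refl = inj₂ (inj₁ (here refl))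
    walk-west (move _ (east _ _ _) _) (there v∈) | inj₁ refl = inj₂ (inj₁ (here refl))

    -- A north step into `v` would come from the diagonal of `w v` and make that diagonal North.
    walk-East-pred : ∀ {u P v} → Walk g u P → v ∈ u ∷ P → East (w v) → v ≡ u ⊎ w v ∈ u ∷ P
    walk-East-pred _ (here refl) _ = inj₁ refl
    walk-East-pred (move _ m W) (there v∈) E with walk-East-pred W v∈ E
    ... | inj₂ r = inj₂ (there r)
    walk-East-pred (move iu (north N _ _) _) (there v∈) E | inj₁ refl = ⊥-elim (East-North E (North-↘ (wn-↘ iu) N))
    walk-East-pred (move _ (neast _ _) _) (there v∈) E | inj₁ refl = inj₂ (here refl)
    walk-East-pred (move _ (east _ _ _) _) (there v∈) E | inj₁ refl = inj₂ (here refl)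

    walk-East-next : ∀ {u P v} → Walk g u P → v ∈ u ∷ P → East v → e v ∈ u ∷ P × g (e v) ≡ g v
    walk-East-next (stop _ N _ _) (here refl) E = ⊥-elim (East-North E N)
    walk-East-next (move _ (north N _ _) _) (here refl) E = ⊥-elim (East-North E N)
    walk-East-next (move _ (neast N _) _) (here refl) E = ⊥-elim (East-North E N)
    walk-East-next (move _ (east _ _ eq) _) (here refl) E = there (here refl) , eq
    walk-East-next (move _ _ W) (there v∈) E with walk-East-next W v∈ E
    ... | p , eq = there p , eq

    walk-vertical : ∀ {u P v} → Walk g u P → v ∈ u ∷ P → n v ∈ u ∷ P → g (n v) ≡ g v
    walk-vertical W v∈ (here eq) = ⊥-elim (path-head-above (walk-path W) v∈ eq)
    walk-vertical (move _ (north _ eq _) _) (here refl) (there _) = eq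
    walk-vertical (move _ (neast _ _) W) (here refl) (there nv∈) =
      ⊥-elim (ℕₚ.<-irrefl refl (proj₂ (path-bounds (walk-path W) nv∈)))
    walk-vertical (move _ (east _ _ _) W) (here refl) (there nv∈) =
      ⊥-elim (ℕₚ.<-irrefl refl (proj₂ (path-bounds (walk-path W) nv∈)))
    walk-vertical (move _ _ W) (there v∈) (there nv∈) = walk-vertical W v∈ nv∈

    walk-end : ∀ {u P} → Walk g u P → ¬ In (e (ω (u ∷ P)))
    walk-end (stop _ _ ¬ie _) = ¬ie
    walk-end (move _ _ W) = walk-end W

  path-diag-injective : ∀ {u P v x} → IsNEPath la (u ∷ P) → v ∈ u ∷ P → x ∈ u ∷ P → content v ≡ content x → v ≡ x
  path-diag-injective _ (here refl) (here refl) _ = refl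
  path-diag-injective {u} (step iu st p) (here refl) (there x∈) eq =
    ⊥-elim (ℤₚ.<-irrefl eq (ℤₚ.<-≤-trans (step-< iu st) (path-content-≤ p x∈)))
  path-diag-injective {u} (step iu st p) (there v∈) (here refl) eq =
    ⊥-elim (ℤₚ.<-irrefl (sym eq) (ℤₚ.<-≤-trans (step-< iu st) (path-content-≤ p v∈)))
  path-diag-injective (step _ _ p) (there v∈) (there x∈) eq = path-diag-injective p v∈ x∈ eq

  -- Insertions and the non-crossing of successive paths

  -- One step read in both directions: it arises from a compatible path in `inserts-insertion` and
  -- from a removal in `walk-insertion`, so its consequences serve uniqueness and existence alike.
  record Insertion (f g : Filling) (u : Cell) (P : List Cell) : Set where
    field
      path     : IsNEPath la (u ∷ P)
      end      : ¬ In (e (ω (u ∷ P)))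
      source   : Rpp f
      target   : Rpp g
      added    : ∀ {v} → v ∈ u ∷ P → g v ≡ suc (f v)
      kept     : ∀ {v} → v ∉ u ∷ P → g v ≡ f v
      eastward : ∀ {v} → v ∈ u ∷ P → East v → e v ∈ u ∷ P × f (e v) ≡ f v
      vertical : ∀ {v} → v ∈ u ∷ P → n v ∈ u ∷ P → f (n v) ≡ f v

  module _ {f g : Filling} {u : Cell} {P : List Cell} (I : Insertion f g u P) where
    open Insertion I

    drop-n : ∀ {v} → v ∈ u ∷ P → n v ∉ u ∷ P → g (n v) < g v
    drop-n {v} v∈ nv∉ = subst₂ _<_ (sym (kept nv∉)) (sym (added v∈)) (s≤s (rpp-n source (path-In path v∈)))

    drop-w : ∀ {v} → v ∈ u ∷ P → w v ∉ u ∷ P → g (w v) < g v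
    drop-w {v} v∈ wv∉ = subst₂ _<_ (sym (kept wv∉)) (sym (added v∈)) (s≤s (rpp-w source (path-In path v∈)))

    private
      -- Compatibility speaks of `f`, a walk of `g`. Equalities along the path survive because both
      -- cells are raised; a north or west neighbour off the path is not raised, which makes its
      -- inequality strict. The hypothesis `split`, that the part already passed lies weakly
      -- south-west of `v`, shows such neighbours to be off the path.
      suffix-walk : ∀ {v S} → IsNEPath la (v ∷ S) → (∀ {x} → x ∈ v ∷ S → x ∈ u ∷ P) →
        (∀ {x} → x ∈ u ∷ P → x ∈ v ∷ S ⊎ (row v ≤ row x × col x ≤ col v)) →
        ω (v ∷ S) ≡ ω (u ∷ P) → Walk g v S
      suffix-walk {v} (single iv) sub split ω≡ with East⊎North iv
      ... | inj₁ E = ⊥-elim (end (subst (λ x → In (e x)) ω≡ (path-In path (proj₁ (eastward (sub (here refl)) E)))))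
      ... | inj₂ N = stop iv N (λ p → end (subst (λ x → In (e x)) ω≡ p)) (drop-n (sub (here refl)) nv∉)
        where
        nv∉ : n v ∉ u ∷ P
        nv∉ nv∈ with split nv∈
        ... | inj₁ (here eq) = path-head-above (single iv) (here refl) eq
        ... | inj₂ (r , _) = n-not-below iv r
      suffix-walk {v} q@(step iv (inj₁ refl) p) sub split ω≡ with East⊎North iv
      ... | inj₁ E = ⊥-elim (ev∉ (proj₁ (eastward (sub (here refl)) E)))
        where
        ev∉ : e v ∉ u ∷ P
        ev∉ ev∈ with split ev∈
        ... | inj₁ (here eq) = ℕₚ.1+n≢n (cong col eq)
        ... | inj₁ (there ev∈′) = n-not-below iv (proj₁ (path-bounds p ev∈′))
        ... | inj₂ (_ , c) = ℕₚ.<-irrefl refl c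
      ... | inj₂ N = move iv (north N g≡ (drop-w (sub (there (here refl))) wnv∉))
                       (suffix-walk p (λ x∈ → sub (there x∈)) (extend-split (inj₁ refl) split) ω≡)
        where
        g≡ : g (n v) ≡ g v
        g≡ = trans (added (sub (there (here refl))))
               (trans (cong suc (vertical (sub (here refl)) (sub (there (here refl))))) (sym (added (sub (here refl)))))
        wnv∉ : w (n v) ∉ u ∷ P
        wnv∉ wnv∈ with split wnv∈
        ... | inj₁ r = ℕₚ.<⇒≱ (ℕₚ.∸-monoʳ-< {o = 0} (s≤s z≤n) (proj₁ iv)) (proj₂ (path-bounds q r))
        ... | inj₂ (r , _) = n-not-below iv r
      suffix-walk {v} q@(step iv (inj₂ refl) p) sub split ω≡ =
        move iv (typed (East⊎North iv)) (suffix-walk p (λ x∈ → sub (there x∈)) (extend-split (inj₂ refl) split) ω≡)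
        where
        nv∉ : n v ∉ u ∷ P
        nv∉ nv∈ with split nv∈
        ... | inj₁ (here eq) = path-head-above q (here refl) eq
        ... | inj₁ (there nv∈′) = ℕₚ.<-irrefl refl (proj₂ (path-bounds p nv∈′))
        ... | inj₂ (r , _) = n-not-below iv r
        typed : East v ⊎ North v → Move g v (e v)
        typed (inj₁ E) with eastward (sub (here refl)) E
        ... | ev∈ , f≡ = east E (drop-n (sub (here refl)) nv∉) (trans (added ev∈) (trans (cong suc f≡) (sym (added (sub (here refl))))))
        typed (inj₂ N) = neast N (drop-n (sub (here refl)) nv∉)

    insertion-walk : Walk g u P
    insertion-walk = suffix-walk path id inj₁ refl

    private
      -- Both walks advance one diagonal at a time with `v` strictly above `x`. The upper one cannot
      -- stop first: a cell below it on its diagonal forces `e v` into the diagram.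
      compare-insert : ∀ {v S x T} → Walk g v S → (∀ {y} → y ∈ v ∷ S → y ∈ u ∷ P) → Walk f x T →
        content v ≡ content x → row v < row x → content (ω (x ∷ T)) ℤ.< content (ω (v ∷ S))
      compare-insert (stop iv _ ¬iev _) _ W eq lt = ⊥-elim (¬iev (In-e-of-below iv (walk-In W) eq lt))
      compare-insert (move iv m W) _ (stop _ _ _ _) eq _ =
        ℤₚ.<-≤-trans (subst (ℤ._< _) eq (step-< iv (move-step m))) (content≤content-ω (walk-path W))
      compare-insert {v} {x = x} (move iv m W) sub (move ix m′ W′) eq lt =
        compare-insert W (λ y∈ → sub (there y∈)) W′ eq′ (rows-< m m′ (walk-In W′) (sub (there (here refl))) eq′)
        where
        eq′ = trans (step-content iv (move-step m)) (trans (cong ℤ.suc eq) (sym (step-content ix (move-step m′))))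
        x∉ : x ∉ u ∷ P
        x∉ x∈ = ℕₚ.<-irrefl (cong row (path-diag-injective path (sub (here refl)) x∈ eq)) lt
        -- The paths cannot cross: otherwise adding u ∷ P would raise n x but not x, although f (n x) = f x.
        northward : In x → f (n x) ≡ f x → e v ∈ u ∷ P → content (e v) ≡ content (n x) → row v < row (n x)
        northward ix f≡ ev∈ c≡ = ℕₚ.≤∧≢⇒< (ℕₚ.∸-monoˡ-≤ 1 lt) λ r≡ →
          let nx≡ev = diag-row-injective c≡ r≡
              gnx = trans (added (subst (_∈ u ∷ P) nx≡ev ev∈)) (cong suc f≡)
          in ℕₚ.<⇒≱ (ℕₚ.≤-reflexive (trans (cong suc (kept x∉)) (sym gnx))) (rpp-n target ix)
        rows-< : ∀ {v′ x′} → Move g v v′ → Move f x x′ → In x′ → v′ ∈ u ∷ P → content v′ ≡ content x′ → row v′ < row x′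
        rows-< (north _ _ _) (north _ _ _) inx _ _ = ℕₚ.∸-monoˡ-< lt (In-row iv)
        rows-< (north _ _ _) (neast _ _) _ _ _ = ℕₚ.≤-<-trans (ℕₚ.m∸n≤m _ 1) lt
        rows-< (north _ _ _) (east _ _ _) _ _ _ = ℕₚ.≤-<-trans (ℕₚ.m∸n≤m _ 1) lt
        rows-< (neast _ _) (north _ f≡ _) _ v′∈ c≡ = northward ix f≡ v′∈ c≡
        rows-< (neast _ _) (neast _ _) _ _ _ = lt
        rows-< (neast _ _) (east _ _ _) _ _ _ = lt
        rows-< (east _ _ _) (north _ f≡ _) _ v′∈ c≡ = northward ix f≡ v′∈ c≡
        rows-< (east _ _ _) (neast _ _) _ _ _ = lt
        rows-< (east _ _ _) (east _ _ _) _ _ _ = lt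

      -- Now the walk of `f` is weakly above and the two may meet. If the path goes north from a
      -- common cell, `vertical` gives `f` equal values there, so the other walk must go north too
      -- and cannot fall below.
      compare-remove : ∀ {v S x T} → Walk g v S → (∀ {y} → y ∈ v ∷ S → y ∈ u ∷ P) → Walk f x T →
        content v ≡ content x → row x ≤ row v → content (ω (v ∷ S)) ℤ.≤ content (ω (x ∷ T))
      compare-remove (stop _ _ _ _) _ W eq _ = ℤₚ.≤-trans (ℤₚ.≤-reflexive eq) (content≤content-ω (walk-path W))
      compare-remove {v} {x = x} (move iv m W) sub W′ eq le with ℕₚ.m≤n⇒m<n∨m≡n le
      compare-remove {v} {x = x} (move iv m W) sub (stop ix _ ¬iex _) eq le | inj₁ lt =
        ⊥-elim (¬iex (In-e-of-below ix iv (sym eq) lt))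
      compare-remove {v} {x = x} (move iv m W) sub (move ix m′ W′) eq le | inj₁ lt =
        compare-remove W (λ y∈ → sub (there y∈)) W′
          (trans (step-content iv (move-step m)) (trans (cong ℤ.suc eq) (sym (step-content ix (move-step m′)))))
          (rows-≤ m m′)
        where
        rows-≤ : ∀ {v′ x′} → Move g v v′ → Move f x x′ → row x′ ≤ row v′
        rows-≤ (north _ _ _) m′ = ℕₚ.≤-trans (proj₁ (step-bounds (move-step m′))) (ℕₚ.∸-monoˡ-≤ 1 lt)
        rows-≤ (neast _ _) m′ = ℕₚ.≤-trans (proj₁ (step-bounds (move-step m′))) le
        rows-≤ (east _ _ _) m′ = ℕₚ.≤-trans (proj₁ (step-bounds (move-step m′))) le
      compare-remove {v} {x = x} (move iv m W) sub W′ eq le | inj₂ r≡ with diag-row-injective (sym eq) r≡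
      compare-remove (move iv (north _ _ _) W) sub (stop _ _ _ lt) eq le | inj₂ _ | refl =
        ⊥-elim (ℕₚ.<-irrefl (vertical (sub (here refl)) (sub (there (here refl)))) lt)
      compare-remove (move iv (neast _ _) W) sub (stop _ _ ¬ie _) eq le | inj₂ _ | refl = ⊥-elim (¬ie (walk-In W))
      compare-remove (move iv (east _ _ _) W) sub (stop _ _ ¬ie _) eq le | inj₂ _ | refl = ⊥-elim (¬ie (walk-In W))
      compare-remove {v} (move iv m W) sub (move ix m′ W′) eq le | inj₂ _ | refl =
        compare-remove W (λ y∈ → sub (there y∈)) W′
          (trans (step-content iv (move-step m)) (sym (step-content ix (move-step m′))))
          (rows-≤ m m′ (sub (there (here refl))))
        where
        rows-≤ : ∀ {v′ x′} → Move g v v′ → Move f v x′ → v′ ∈ u ∷ P → row x′ ≤ row v′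
        rows-≤ (north _ _ _) (north _ _ _) _ = ℕₚ.≤-refl
        rows-≤ (north _ _ _) (neast _ lt) v′∈ = ⊥-elim (ℕₚ.<-irrefl (vertical (sub (here refl)) v′∈) lt)
        rows-≤ (north _ _ _) (east _ lt _) v′∈ = ⊥-elim (ℕₚ.<-irrefl (vertical (sub (here refl)) v′∈) lt)
        rows-≤ (neast _ _) m′ _ = proj₁ (step-bounds (move-step m′))
        rows-≤ (east _ _ _) m′ _ = proj₁ (step-bounds (move-step m′))

    -- For uniqueness: among increasing hooks on one starting diagonal, it prevents the later
    -- insertion from starting above the earlier one.
    below-ends-earlier : ∀ {x T} → Walk f x T → content u ≡ content x → row u < row x →
      content (ω (x ∷ T)) ℤ.< content (ω (u ∷ P))
    below-ends-earlier = compare-insert insertion-walk id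

    -- For existence: once the starts are known to be in the right order on a diagonal, it puts the
    -- ends in the right order.
    above-ends-later : ∀ {x T} → Walk f x T → content u ≡ content x → row x ≤ row u →
      content (ω (u ∷ P)) ℤ.≤ content (ω (x ∷ T))
    above-ends-later = compare-remove insertion-walk id

  -- The greatest candidate

  -- Removal starts in the ≺-greatest candidate.
  infix 4 _≺_
  _≺_ : Cell → Cell → Set
  u ≺ v = content u ℤ.< content v ⊎ (content u ≡ content v × row u < row v)

  ≺-irrefl : ∀ {u} → ¬ (u ≺ u)
  ≺-irrefl (inj₁ lt) = ℤₚ.<-irrefl refl lt
  ≺-irrefl (inj₂ (_ , lt)) = ℕₚ.<-irrefl refl lt

  ≺-trans : ∀ {u v x} → u ≺ v → v ≺ x → u ≺ x
  ≺-trans (inj₁ p) (inj₁ q) = inj₁ (ℤₚ.<-trans p q)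
  ≺-trans (inj₁ p) (inj₂ (q , _)) = inj₁ (subst (_ ℤ.<_) q p)
  ≺-trans (inj₂ (p , _)) (inj₁ q) = inj₁ (subst (ℤ._< _) (sym p) q)
  ≺-trans (inj₂ (p , r)) (inj₂ (q , t)) = inj₂ (trans p q , ℕₚ.<-trans r t)

  ≺-total : ∀ u v → u ≺ v ⊎ u ≡ v ⊎ v ≺ u
  ≺-total u v with ℤₚ.<-cmp (content u) (content v)
  ... | tri< lt _ _ = inj₁ (inj₁ lt)
  ... | tri> _ _ gt = inj₂ (inj₂ (inj₁ gt))
  ... | tri≈ _ eq _ with ℕₚ.<-cmp (row u) (row v)
  ...   | tri< lt _ _ = inj₁ (inj₂ (eq , lt))
  ...   | tri≈ _ r _ = inj₂ (inj₁ (diag-row-injective eq r))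
  ...   | tri> _ _ gt = inj₂ (inj₂ (inj₂ (sym eq , gt)))

  Candidate : Filling → Cell → Set
  Candidate g u = East (w u) × g (w u) < g u

  -- `beyond` is an equation rather than the absence of candidates, since equations are kept when
  -- both sides change together.
  record Top (g : Filling) (u : Cell) : Set where
    field
      inside    : In u
      candidate : Candidate g u
      beyond    : ∀ {v} → In v → East (w v) → u ≺ v → g v ≡ g (w v)

  Top-unique : ∀ {g u v} → Top g u → Top g v → u ≡ v
  Top-unique {g} {u} {v} t t′ with ≺-total u v
  ... | inj₁ u≺v = ⊥-elim (ℕₚ.<-irrefl (sym (Top.beyond t (Top.inside t′) (proj₁ (Top.candidate t′)) u≺v)) (proj₂ (Top.candidate t′)))
  ... | inj₂ (inj₁ eq) = eq
  ... | inj₂ (inj₂ v≺u) = ⊥-elim (ℕₚ.<-irrefl (sym (Top.beyond t′ (Top.inside t) (proj₁ (Top.candidate t)) v≺u)) (proj₂ (Top.candidate t)))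

  -- On the diagonal of `u` the rows decide, as a path never goes below its head. On later diagonals
  -- `w v` leads only to `v`, and `v` is entered only from `w v`.
  walk-beyond : ∀ {g u P v} → Walk g u P → In v → East (w v) → u ≺ v →
    (v ∈ u ∷ P × w v ∈ u ∷ P) ⊎ (v ∉ u ∷ P × w v ∉ u ∷ P)
  walk-beyond {P = P} W iv E (inj₂ (_ , lt)) = inj₂ (not-in , not-in)
    where
    not-in : ∀ {j} → (_ , j) ∉ _ ∷ P
    not-in x∈ = ℕₚ.<⇒≱ lt (proj₁ (path-bounds (walk-path W) x∈))
  walk-beyond {u = u} {P} {v@(i , suc j)} W iv E (inj₁ lt) with v ∈? (u ∷ P) | w v ∈? (u ∷ P)
  ... | yes p | yes q = inj₁ (p , q)
  ... | no p | no q = inj₂ (p , q)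
  ... | no p | yes q = ⊥-elim (p (proj₁ (walk-East-next W q E)))
  ... | yes p | no q with walk-East-pred W p E
  ...   | inj₁ refl = ⊥-elim (ℤₚ.<-irrefl refl lt)
  ...   | inj₂ r = ⊥-elim (q r)

  module _ {f g : Filling} {u : Cell} {P : List Cell} (I : Insertion f g u P) where
    open Insertion I

    beyond-target : ∀ {v} → In v → East (w v) → u ≺ v → f v ≡ f (w v) → g v ≡ g (w v)
    beyond-target iv E u≺v eq with walk-beyond (insertion-walk I) iv E u≺v
    ... | inj₁ (p , q) = trans (added p) (trans (cong suc eq) (sym (added q)))
    ... | inj₂ (p , q) = trans (kept p) (trans eq (sym (kept q)))

    beyond-source : ∀ {v} → In v → East (w v) → u ≺ v → g v ≡ g (w v) → f v ≡ f (w v)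
    beyond-source iv E u≺v eq with walk-beyond (insertion-walk I) iv E u≺v
    ... | inj₁ (p , q) = ℕₚ.suc-injective (trans (sym (added p)) (trans eq (added q)))
    ... | inj₂ (p , q) = trans (sym (kept p)) (trans eq (kept q))

    w-head∉ : w u ∉ u ∷ P
    w-head∉ wu∈ = ℕₚ.<⇒≱ (ℕₚ.∸-monoʳ-< {o = 0} (s≤s z≤n) (proj₁ (path-In path (here refl)))) (proj₂ (path-bounds path wu∈))

    insertion-Top : East (w u) → (∀ {v} → In v → East (w v) → u ≺ v → f v ≡ f (w v)) → Top g u
    insertion-Top E f≡ = record
      { inside = path-In path (here refl)
      ; candidate = E , drop-w I (here refl) w-head∉
      ; beyond = λ iv Ev u≺v → beyond-target iv Ev u≺v (f≡ iv Ev u≺v)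
      }

  -- Subtracting a path

  infixl 6 _-P_
  _-P_ : Filling → List Cell → Filling
  (g -P P) v = if does (v ∈? P) then pred (g v) else g v

  -P-∈ : ∀ g {P v} → v ∈ P → (g -P P) v ≡ pred (g v)
  -P-∈ g {P} {v} v∈ with v ∈? P
  ... | yes _ = refl
  ... | no v∉ = ⊥-elim (v∉ v∈)

  -P-∉ : ∀ g {P v} → v ∉ P → (g -P P) v ≡ g v
  -P-∉ g {P} {v} v∉ with v ∈? P
  ... | yes v∈ = ⊥-elim (v∉ v∈)
  ... | no _ = refl

  -P-≤ : ∀ g P v → (g -P P) v ≤ g v
  -P-≤ g P v with v ∈? P
  ... | yes _ = ℕₚ.pred[n]≤n
  ... | no _ = ℕₚ.≤-refl

  -P-mono : ∀ g P {v x} → g v ≤ g x → (x ∈ P → v ∈ P ⊎ g v < g x) → (g -P P) v ≤ (g -P P) x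
  -P-mono g P {v} {x} le strict with x ∈? P
  ... | no x∉ = ℕₚ.≤-trans (-P-≤ g P v) le
  ... | yes x∈ with strict x∈
  ...   | inj₁ v∈ = subst (_≤ pred (g x)) (sym (-P-∈ g v∈)) (ℕₚ.pred-mono-≤ le)
  ...   | inj₂ lt = ℕₚ.≤-trans (-P-≤ g P v) (ℕₚ.pred-mono-≤ lt)

  +P-∈ : ∀ f {P v} → v ∈ P → (f +P P) v ≡ suc (f v)
  +P-∈ f {P} {v} v∈ with v ∈? P
  ... | yes _ = refl
  ... | no v∉ = ⊥-elim (v∉ v∈)

  +P-∉ : ∀ f {P v} → v ∉ P → (f +P P) v ≡ f v
  +P-∉ f {P} {v} v∉ with v ∈? P
  ... | yes v∈ = ⊥-elim (v∉ v∈)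
  ... | no _ = refl

  module _ {g : Filling} {u : Cell} {P : List Cell} (G : Rpp g) (W : Walk g u P) (start : g (w u) < g u) where
    private
      L = u ∷ P
      f = g -P L

      f≤g : ∀ v → f v ≤ g v
      f≤g = -P-≤ g L

      f-suc : ∀ {v} → v ∈ L → g v ≡ suc (f v)
      f-suc {v} v∈ = trans (sym (suc-pred (walk-positive W v∈))) (cong suc (sym (-P-∈ g v∈)))
        where
        suc-pred : ∀ {m} → 0 < m → suc (pred m) ≡ m
        suc-pred (s≤s _) = refl

      f-Rpp : Rpp f
      f-Rpp = record
        { outside = λ {v} ¬iv → ℕₚ.n≤0⇒n≡0 (ℕₚ.≤-trans (f≤g v) (ℕₚ.≤-reflexive (Rpp.outside G ¬iv)))
        ; mono-e = λ iev → -P-mono g L (Rpp.mono-e G iev) (λ ev∈ → west (walk-west W ev∈))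
        ; mono-s = λ isv → -P-mono g L (Rpp.mono-s G isv) (walk-north W)
        }
        where
        west : ∀ {v} → e v ≡ u ⊎ v ∈ L ⊎ g v < g (e v) → v ∈ L ⊎ g v < g (e v)
        west (inj₁ refl) = inj₂ start
        west (inj₂ r) = r

    walk-insertion : Insertion (g -P (u ∷ P)) g u P
    walk-insertion = record
      { path = walk-path W
      ; end = walk-end W
      ; source = f-Rpp
      ; target = G
      ; added = f-suc
      ; kept = λ v∉ → sym (-P-∉ g v∉)
      ; eastward = λ v∈ E → let ev∈ , eq = walk-East-next W v∈ E
                            in ev∈ , trans (-P-∈ g ev∈) (trans (cong pred eq) (sym (-P-∈ g v∈)))
      ; vertical = λ v∈ nv∈ → trans (-P-∈ g nv∈) (trans (cong pred (walk-vertical W v∈ nv∈)) (sym (-P-∈ g v∈)))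
      }

  -- Existence of the removal walk

  rpp-positive : ∀ {g v} → Rpp g → 0 < g v → In v
  rpp-positive {v = v} G pos with In? v
  ... | yes iv = iv
  ... | no ¬iv = ⊥-elim (ℕₚ.<-irrefl (sym (Rpp.outside G ¬iv)) pos)

  rpp-nw : ∀ {g v} → Rpp g → In v → g (w (n v)) ≤ g (w v)
  rpp-nw {g} {v = v} G iv with In? (w (n v))
  ... | no ¬p = subst (_≤ g (w v)) (sym (Rpp.outside G ¬p)) z≤n
  rpp-nw {v = zero , _} G iv | yes p = ⊥-elim (ℕₚ.<⇒≱ (In-row iv) z≤n)
  rpp-nw {v = suc i , j} G iv | yes p = Rpp.mono-s G (In-mono iv (s≤s z≤n) (proj₁ p) ℕₚ.≤-refl (ℕₚ.m∸n≤m j 1))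

  In-col : ∀ {u} → In u → col u ≤ rowLen la 1
  In-col iu = ℕₚ.≤-trans (proj₂ iu) (rowLen-antitone (proj₁ part) ℕₚ.≤-refl (In-row iu))

  module _ {g : Filling} {u : Cell} (G : Rpp g) (T : Top g u) where
    open Top T

    private
      -- g (w (n v)) < g v is kept along the removal path: it says that g stays a partition on the diagonal of v.
      walk-exists′ : ∀ k {v} → row v + rowLen la 1 ≤ k + col v → In v → content u ℤ.≤ content v →
        g (w (n v)) < g v → ∃ (Walk g v)
      walk-exists′ zero le iv _ _ = ⊥-elim (ℕₚ.<⇒≱ (ℕₚ.+-mono-≤ (In-row iv) (In-col iv)) le)
      walk-exists′ (suc k) {v} le iv u≤v nw< with East⊎North iv
      ... | inj₁ E@(x , v↘x , iex , _) = _ , move iv (east E nv< gev) (proj₂ rest)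
        where
        iev : In (e v)
        iev = In-↘ iex (In-row iv) (s≤s z≤n) (↘-e v↘x)
        u≺ : ∀ {x} → content x ≡ ℤ.suc (content v) → u ≺ x
        u≺ eq = inj₁ (ℤₚ.≤-<-trans u≤v (subst (content v ℤ.<_) (sym eq) (i<suc-i _)))
        -- Both `e v` and `n v` lie on the next diagonal, hence beyond `u`, and their west
        -- neighbours lie on the East diagonal of `v`. As neither is a candidate, each inside the
        -- diagram has the value of its west neighbour.
        gev : g (e v) ≡ g v
        gev = beyond iev E (u≺ (content-e v))
        nv< : g (n v) < g v
        nv< with In? (n v)
        ... | yes inv = subst (_< g v) (sym (beyond inv (East-↘ (wn-↘ iv) E) (u≺ (content-n v (In-row iv))))) nw<
        ... | no ¬inv = subst (_< g v) (sym (Rpp.outside G ¬inv)) (ℕₚ.≤-<-trans z≤n nw<)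
        rest : ∃ (Walk g (e v))
        rest = walk-exists′ k (ℕₚ.≤-trans le (ℕₚ.≤-reflexive (sym (ℕₚ.+-suc k (col v))))) iev
                 (ℤₚ.<⇒≤ (ℤₚ.≤-<-trans u≤v (step-< iv (inj₂ refl)))) (subst (g (n v) <_) (sym gev) nv<)
      ... | inj₂ N with g (n v) ℕₚ.≟ g v
      ...   | yes eq = _ , move iv (north N eq wn<) (proj₂ rest)
        where
        wn< : g (w (n v)) < g (n v)
        wn< = subst (g (w (n v)) <_) (sym eq) nw<
        inv : In (n v)
        inv = rpp-positive G (ℕₚ.≤-<-trans z≤n wn<)
        rest : ∃ (Walk g (n v))
        rest = walk-exists′ k (fuel iv le) inv (ℤₚ.<⇒≤ (ℤₚ.≤-<-trans u≤v (step-< iv (inj₁ refl))))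
                 (ℕₚ.≤-<-trans (rpp-nw G inv) wn<)
          where
          fuel : ∀ {v c k} → In v → row v + c ≤ suc k + col v → row (n v) + c ≤ k + col v
          fuel {zero , _} iv _ = ⊥-elim (ℕₚ.<⇒≱ (In-row iv) z≤n)
          fuel {suc i , _} _ (s≤s le) = le
      ...   | no ne with In? (e v) | ℕₚ.≤∧≢⇒< (rpp-n G iv) ne
      ...     | no ¬iev | nv< = _ , stop iv N ¬iev nv<
      ...     | yes iev | nv< = _ , move iv (neast N nv<) (proj₂ rest)
        where
        rest : ∃ (Walk g (e v))
        rest = walk-exists′ k (ℕₚ.≤-trans le (ℕₚ.≤-reflexive (sym (ℕₚ.+-suc k (col v))))) iev
                 (ℤₚ.<⇒≤ (ℤₚ.≤-<-trans u≤v (step-< iv (inj₂ refl)))) (ℕₚ.<-≤-trans nv< (Rpp.mono-e G iev))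

    walk-exists : ∃ (Walk g u)
    walk-exists = walk-exists′ (row u + rowLen la 1) (ℕₚ.m≤m+n _ _) inside ℤₚ.≤-refl
      (ℕₚ.≤-<-trans (rpp-nw G inside) (proj₂ candidate))

  -- Existence of the greatest candidate

  maximal-candidate : ∀ g xs → All In xs → (∀ {x} → x ∈ xs → ¬ Candidate g x)
    ⊎ (∃ λ u → In u × Candidate g u × (∀ {v} → v ∈ xs → Candidate g v → ¬ (u ≺ v)))
  maximal-candidate g [] [] = inj₁ λ ()
  maximal-candidate g (x ∷ xs) (ix ∷ is) with East-w? ix ×-dec (g (w x) <? g x) | maximal-candidate g xs is
  ... | no ¬c | inj₁ none = inj₁ λ { (here refl) → ¬c ; (there v∈) → none v∈ }
  ... | no ¬c | inj₂ (u , iu , cu , max) = inj₂ (u , iu , cu , λ { (here refl) c → ⊥-elim (¬c c) ; (there v∈) → max v∈ })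
  ... | yes c | inj₁ none = inj₂ (x , ix , c , λ { (here refl) _ → ≺-irrefl ; (there v∈) c → ⊥-elim (none v∈ c) })
  ... | yes c | inj₂ (u , iu , cu , max) with ≺-total u x
  ...   | inj₁ u≺x = inj₂ (x , ix , c , λ { (here refl) _ → ≺-irrefl ; (there v∈) c x≺v → max v∈ c (≺-trans u≺x x≺v) })
  ...   | inj₂ (inj₁ refl) = inj₂ (u , iu , cu , λ { (here refl) _ → ≺-irrefl ; (there v∈) → max v∈ })
  ...   | inj₂ (inj₂ x≺u) = inj₂ (u , iu , cu , λ { (here refl) _ u≺x → ≺-irrefl (≺-trans x≺u u≺x) ; (there v∈) → max v∈ })

  East-w : ∀ {u} → In u → ¬ In (s u) → East (w u)
  East-w {i , suc j} iu ¬isu = (i , j) , ↘-refl , iu , ¬isu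

  -- A positive entry propagates to the south while this is possible, and then to the west until a candidate is found.
  positive⇒candidate : ∀ {g} → Rpp g → ∀ k u → length la + col u ≤ k + row u → In u → 0 < g u →
    ∃ λ v → In v × Candidate g v
  positive⇒candidate G zero u le iu _ = ⊥-elim (ℕₚ.<⇒≱
    (ℕₚ.+-mono-≤-< (proj₂ (rowLen-length la (ℕₚ.≤-trans (proj₁ iu) (proj₂ iu)))) (proj₁ iu))
    (ℕₚ.≤-trans le (ℕₚ.≤-reflexive (sym (ℕₚ.+-identityʳ (row u))))))
  positive⇒candidate {g} G (suc k) u@(i , suc j) le iu pos with In? (s u) | g (w u) <? g u
  ... | yes isu | _ = positive⇒candidate G k (s u) (ℕₚ.≤-trans le (ℕₚ.≤-reflexive (sym (ℕₚ.+-suc k i))))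
                        isu (ℕₚ.<-≤-trans pos (Rpp.mono-s G isu))
  ... | no ¬isu | yes lt = u , iu , East-w iu ¬isu , lt
  ... | no _ | no ≮ = positive⇒candidate G k (w u)
      (ℕₚ.≤-pred (ℕₚ.≤-trans (ℕₚ.≤-reflexive (sym (ℕₚ.+-suc (length la) j))) le))
      (rpp-positive G pos′) pos′
    where
    pos′ : 0 < g (w u)
    pos′ = ℕₚ.<-≤-trans pos (ℕₚ.≮⇒≥ ≮)

  box : List Cell
  box = cartesianProduct (upTo (suc (length la))) (upTo (suc (rowLen la 1)))

  cells : List Cell
  cells = filter In? box

  cells-In : All In cells
  cells-In = all-filter In? box

  ∈-cells : ∀ {u} → In u → u ∈ cells
  ∈-cells iu = ∈-filter⁺ In? (∈-cartesianProduct⁺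
    (∈-upTo⁺ (s≤s (proj₂ (rowLen-length la (ℕₚ.≤-trans (proj₁ iu) (proj₂ iu)))))) (∈-upTo⁺ (s≤s (In-col iu)))) iu

  Top-exists : ∀ {g} → Rpp g → ∃ (Top g) ⊎ (∀ {u} → In u → g u ≡ 0)
  Top-exists {g} G with maximal-candidate g cells cells-In
  ... | inj₁ none = inj₂ λ {u} iu → ℕₚ.n≤0⇒n≡0 (ℕₚ.≮⇒≥ λ pos →
        let v , iv , c = positive⇒candidate G (length la + col u) u (ℕₚ.m≤m+n _ _) iu pos in none (∈-cells iv) c)
  ... | inj₂ (u , iu , c , max) = inj₁ (u , record
        { inside = iu ; candidate = c
        ; beyond = λ iv E u≺v → ℕₚ.≤-antisym (ℕₚ.≮⇒≥ λ lt → max (∈-cells iv) (E , lt) u≺v) (rpp-w G iv) })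

  -- Normalised fillings and the translation of insertions

  size : Filling → ℕ
  size g = sum (map g cells)

  -- Fillings are arbitrary outside the diagram, whereas `Rpp` asks for zeros there.
  norm : Filling → Filling
  norm σ u with In? u
  ... | yes _ = σ u
  ... | no _ = 0

  norm-In : ∀ σ {u} → In u → norm σ u ≡ σ u
  norm-In σ {u} iu with In? u
  ... | yes _ = refl
  ... | no ¬iu = ⊥-elim (¬iu iu)

  norm-out : ∀ σ {u} → ¬ In u → norm σ u ≡ 0
  norm-out σ {u} ¬iu with In? u
  ... | yes iu = ⊥-elim (¬iu iu)
  ... | no _ = refl

  norm-Rpp : ∀ {σ} → IsRPP la σ → Rpp (norm σ)
  norm-Rpp {σ} R = record { outside = norm-out σ ; mono-e = mono-e ; mono-s = mono-s }
    where
    mono-e : ∀ {u} → In (e u) → norm σ u ≤ norm σ (e u)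
    mono-e {u} ieu with In? u
    ... | yes iu = subst (σ u ≤_) (sym (norm-In σ ieu)) (proj₁ (R u iu) ieu)
    ... | no _ = z≤n
    mono-s : ∀ {u} → In (s u) → norm σ u ≤ norm σ (s u)
    mono-s {u} isu with In? u
    ... | yes iu = subst (σ u ≤_) (sym (norm-In σ isu)) (proj₂ (R u iu) isu)
    ... | no _ = z≤n

  norm-Rpp-id : ∀ {g} → Rpp g → ∀ u → norm g u ≡ g u
  norm-Rpp-id {g} G u with In? u
  ... | yes _ = refl
  ... | no ¬iu = sym (Rpp.outside G ¬iu)

  Rpp⇒IsRPP : ∀ {g} → Rpp g → IsRPP la g
  Rpp⇒IsRPP G u _ = Rpp.mono-e G , Rpp.mono-s G

  walk-cong : ∀ {f g u P} → (∀ v → f v ≡ g v) → Walk f u P → Walk g u P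
  walk-cong eq (stop iu N ¬ie lt) = stop iu N ¬ie (subst₂ _<_ (eq _) (eq _) lt)
  walk-cong {f} {g} eq (move iu m W) = move iu (move-cong m) (walk-cong eq W)
    where
    move-cong : ∀ {u v} → Move f u v → Move g u v
    move-cong (north N f≡ lt) = north N (trans (sym (eq _)) (trans f≡ (eq _))) (subst₂ _<_ (eq _) (eq _) lt)
    move-cong (neast N lt) = neast N (subst₂ _<_ (eq _) (eq _) lt)
    move-cong (east E lt f≡) = east E (subst₂ _<_ (eq _) (eq _) lt) (trans (sym (eq _)) (trans f≡ (eq _)))

  IsRPP-≈ : ∀ {σ τ} → σ ≈[ la ] τ → IsRPP la τ → IsRPP la σ
  IsRPP-≈ eq R u iu = (λ ie → subst₂ _≤_ (sym (eq u iu)) (sym (eq (e u) ie)) (proj₁ (R u iu) ie))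
                    , (λ is → subst₂ _≤_ (sym (eq u iu)) (sym (eq (s u) is)) (proj₂ (R u iu) is))

  InsertsTo-IsRPP : ∀ hs {σ} → InsertsTo la hs σ → IsRPP la σ
  InsertsTo-IsRPP [] eq = IsRPP-≈ eq (λ _ _ → (λ _ → z≤n) , (λ _ → z≤n))
  InsertsTo-IsRPP (h ∷ hs) (τ , _ , P , _ , _ , _ , _ , R , eq) = IsRPP-≈ eq R

  InsertsTo-≈ : ∀ hs {σ τ} → τ ≈[ la ] σ → InsertsTo la hs σ → InsertsTo la hs τ
  InsertsTo-≈ [] eq z u iu = trans (eq u iu) (z u iu)
  InsertsTo-≈ (h ∷ hs) eq (τ , to , P , p , c , ωeq , ℓeq , R , σ≈) =
    τ , to , P , p , c , ωeq , ℓeq , R , λ u iu → trans (eq u iu) (σ≈ u iu)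

  inserts-insertion : ∀ {u P τ σ} → IsRPP la τ → IsNEPath la (u ∷ P) → ¬ In (e (ω (u ∷ P))) →
    Compatible la τ (u ∷ P) → IsRPP la (τ +P (u ∷ P)) → σ ≈[ la ] (τ +P (u ∷ P)) →
    Insertion (norm τ) (norm σ) u P
  inserts-insertion {u} {P} {τ} {σ} R p end (cE , cN) R′ eq = record
    { path = p
    ; end = end
    ; source = norm-Rpp R
    ; target = norm-Rpp (IsRPP-≈ eq R′)
    ; added = λ v∈ → let iv = path-In p v∈ in
        trans (norm-In σ iv) (trans (eq _ iv) (trans (+P-∈ τ v∈) (cong suc (sym (norm-In τ iv)))))
    ; kept = kept
    ; eastward = λ v∈ E → let ev∈ , τ≡ = cE _ v∈ (East⇒IA (path-In p v∈) E) in
        ev∈ , trans (norm-In τ (path-In p ev∈)) (trans τ≡ (sym (norm-In τ (path-In p v∈))))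
    ; vertical = λ v∈ nv∈ →
        trans (norm-In τ (path-In p nv∈)) (trans (cN _ v∈ nv∈) (sym (norm-In τ (path-In p v∈))))
    }
    where
    kept : ∀ {v} → v ∉ u ∷ P → norm σ v ≡ norm τ v
    kept {v} v∉ with In? v
    ... | yes iv = trans (eq v iv) (+P-∉ τ v∉)
    ... | no _ = refl

  insertion-compatible : ∀ {f g u P} → Insertion f g u P → Compatible la f (u ∷ P)
  insertion-compatible I = (λ v v∈ IA → eastward v∈ (type IA (East⊎North (path-In path v∈))))
                         , (λ v → vertical)
    where
    open Insertion I
    type : ∀ {v} → InI la v ⊎ InA la v → East v ⊎ North v → East v
    type _ (inj₁ E) = E
    type IA (inj₂ N) = ⊥-elim (IA⇒¬North IA N)

  insertion-≡ : ∀ {f g u P} → Insertion f g u P → ∀ v → g v ≡ (f +P (u ∷ P)) v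
  insertion-≡ {f} {u = u} {P} I v = case (v ∈? (u ∷ P)) of λ
    { (yes v∈) → trans (added v∈) (sym (+P-∈ f v∈))
    ; (no v∉) → trans (kept v∉) (sym (+P-∉ f v∉)) }
    where open Insertion I

  -- Rim-hooks

  -- Every cell of the walk is pushed down its diagonal to the rim. The last one is there already,
  -- since its east neighbour is outside, so the two paths end in the same cell.
  rim-hook-along : ∀ {g u P} → Walk g u P → ∀ {v} → u ↘ v → In v → ¬ In (e (s v)) →
    ∃ λ H → IsNEPath la (v ∷ H) × ω (v ∷ H) ≡ ω (u ∷ P) × length H ≡ length P
          × (∀ x → x ∈ v ∷ H → ¬ In (e (s x)))
  rim-hook-along (stop iu N ¬ieu _) u↘v iv ¬iesv with ℕₚ.m≤n⇒m<n∨m≡n (rows u↘v)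
  ... | inj₁ lt = ⊥-elim (¬ieu (In-e-of-below iu iv (diag u↘v) lt))
  ... | inj₂ eq with diag-row-injective (diag u↘v) eq
  ...   | refl = [] , single iu , refl , refl , λ { _ (here refl) → ¬iesv }
  rim-hook-along {u = u} (move {v = u′} iu m W) {v} u↘v iv ¬iesv = along (next m)
    where
    North-end : North u → ¬ In (e v)
    North-end N iev = East-North (v , ↘-refl , iev , ¬iesv) (North-diag (diag u↘v) iv N)
    next-content : ∀ {v′} → NEStep v v′ → content u′ ≡ content v′
    next-content st = trans (step-content iu (move-step m)) (trans (cong ℤ.suc (diag u↘v)) (sym (step-content iv st)))
    n-rim : ∀ {v} → In v → ¬ In (e v) → ¬ In (e (s (n v)))
    n-rim {zero , _} iv _ = ⊥-elim (ℕₚ.<⇒≱ (In-row iv) z≤n)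
    n-rim {suc i , _} _ ¬iev = ¬iev
    northward : North u → row u′ ≤ row (n v) → ∃ λ v′ → NEStep v v′ × u′ ↘ v′ × In v′ × ¬ In (e (s v′))
    northward N le = n v , inj₁ refl , nw (next-content (inj₁ refl)) le
      , In-mono iv (ℕₚ.≤-trans (In-row (walk-In W)) le) (proj₁ iv) (ℕₚ.m∸n≤m (row v) 1) ℕₚ.≤-refl
      , n-rim iv (North-end N)
    next : Move _ u u′ → ∃ λ v′ → NEStep v v′ × u′ ↘ v′ × In v′ × ¬ In (e (s v′))
    next (north N _ _) = northward N (ℕₚ.∸-monoˡ-≤ 1 (rows u↘v))
    -- The walk goes east where the rim goes north. This keeps it above the rim because `u` is
    -- strictly above `v`: `e u` is inside and `e v` is not.
    next (neast N _) = northward N (ℕₚ.∸-monoˡ-≤ 1 (ℕₚ.≤∧≢⇒< (rows u↘v) λ eq →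
      North-end N (subst (λ x → In (e x)) (diag-row-injective (diag u↘v) eq) (walk-In W))))
    next (east E _ _) with In? (e v)
    ... | yes iev = e v , inj₂ refl , ↘-e u↘v , iev
                  , λ p → ¬iesv (In-mono p (s≤s z≤n) (s≤s z≤n) ℕₚ.≤-refl (ℕₚ.n≤1+n _))
    ... | no ¬iev = ⊥-elim (East-North E (v , u↘v , iv , ¬iev))
    along : (∃ λ v′ → NEStep v v′ × u′ ↘ v′ × In v′ × ¬ In (e (s v′))) → _
    along (v′ , st , u′↘v′ , iv′ , rim) with rim-hook-along W u′↘v′ iv′ rim
    ... | H , p , ωeq , len , rims = v′ ∷ H , step iv st p , ωeq , cong suc len
                                   , λ { _ (here refl) → ¬iesv ; x (there x∈) → rims x x∈ }

  path-content-cancel : ∀ {u P v Q} → IsNEPath la (u ∷ P) → IsNEPath la (v ∷ Q) →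
    ω (u ∷ P) ≡ ω (v ∷ Q) → length P ≡ length Q → content u ≡ content v
  path-content-cancel (single _) (single _) eq _ = cong content eq
  path-content-cancel (step iu st p) (step iv st′ q) eq len = ℤ-suc-injective
    (trans (sym (step-content iu st)) (trans (path-content-cancel p q eq (ℕₚ.suc-injective len)) (step-content iv st′)))

  rim-diag-injective : ∀ {u v} → In u → In v → ¬ In (e (s u)) → ¬ In (e (s v)) → content u ≡ content v → u ≡ v
  rim-diag-injective {u} {v} iu iv ru rv eq with ℕₚ.<-cmp (row u) (row v)
  ... | tri< lt _ _ = ⊥-elim (ru (In-↘ iv (s≤s z≤n) (s≤s z≤n) (↘-strict eq lt)))
  ... | tri≈ _ r _ = diag-row-injective eq r
  ... | tri> _ _ gt = ⊥-elim (rv (In-↘ iu (s≤s z≤n) (s≤s z≤n) (↘-strict (sym eq) gt)))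

  -- A diagonal has only one rim cell, so the contents passed determine the path.
  rim-path-unique : ∀ {u P v Q} → IsNEPath la (u ∷ P) → IsNEPath la (v ∷ Q) →
    (∀ x → x ∈ u ∷ P → ¬ In (e (s x))) → (∀ x → x ∈ v ∷ Q → ¬ In (e (s x))) →
    content u ≡ content v → length P ≡ length Q → u ∷ P ≡ v ∷ Q
  rim-path-unique (single iu) (single iv) rp rq eq _ =
    cong (_∷ []) (rim-diag-injective iu iv (rp _ (here refl)) (rq _ (here refl)) eq)
  rim-path-unique (step iu st p) (step iv st′ q) rp rq eq len = cong₂ _∷_
    (rim-diag-injective iu iv (rp _ (here refl)) (rq _ (here refl)) eq)
    (rim-path-unique p q (λ x x∈ → rp x (there x∈)) (λ x x∈ → rq x (there x∈))
      (trans (step-content iu st) (trans (cong ℤ.suc eq) (sym (step-content iv st′)))) (ℕₚ.suc-injective len))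

  ω-In : ∀ {P} → IsNEPath la P → In (ω P)
  ω-In (single iu) = iu
  ω-In (step _ _ p) = ω-In p

  α-In : ∀ {P} → IsNEPath la P → In (α P)
  α-In (single iu) = iu
  α-In (step iu _ _) = iu

  -- The order of rim-hooks in terms of contents

  bottom-content-< : ∀ {u v} → In u → In v → ¬ In (s v) → col v < col u → content v ℤ.< content u
  bottom-content-< {u} {v} iu iv ¬isv lt = content-<⁺ v u (ℕₚ.+-mono-<-≤ lt (ℕₚ.≮⇒≥ λ gt →
    ¬isv (In-mono iu (s≤s z≤n) (proj₁ iv) gt (ℕₚ.<⇒≤ lt))))

  bottom-row-≤ : ∀ {u v} → In u → ¬ In (s v) → 1 ≤ col v → col v ≡ col u → row u ≤ row v
  bottom-row-≤ iu ¬isv c eq = ℕₚ.≮⇒≥ λ gt → ¬isv (In-mono iu (s≤s z≤n) c gt (ℕₚ.≤-reflexive eq))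

  bottom-content-≡ : ∀ {u v} → In u → ¬ In (s u) → In v → ¬ In (s v) → col u ≡ col v → content u ≡ content v
  bottom-content-≡ iu ¬isu iv ¬isv eq = cong₂ (λ i j → content (i , j))
    (ℕₚ.≤-antisym (bottom-row-≤ iu ¬isv (proj₁ iv) (sym eq)) (bottom-row-≤ iv ¬isu (proj₁ iu) eq)) eq

  right-end-col-≤ : ∀ {u v} → In u → In v → ¬ In (e v) → row v ≤ row u → col u ≤ col v
  right-end-col-≤ iu iv ¬iev le = ℕₚ.≮⇒≥ λ gt → ¬iev (In-mono iu (In-row iv) (s≤s z≤n) le gt)

  module _ {h h₂ : List Cell} {u u₂ : Cell} (R : IsRimHook la h) (R₂ : IsRimHook la h₂)
           (αu : content (α h) ≡ content u) (αu₂ : content (α h₂) ≡ content u₂) where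
    private
      a = α-In (proj₁ R)
      a₂ = α-In (proj₁ R₂)
      o = ω-In (proj₁ R)
      o₂ = ω-In (proj₁ R₂)
      ¬sa = proj₁ (proj₂ R)
      ¬sa₂ = proj₁ (proj₂ R₂)
      ¬eo = proj₁ (proj₂ (proj₂ R))
      ¬eo₂ = proj₁ (proj₂ (proj₂ R₂))

    -- Feet of columns have contents increasing with the column, which settles different starting
    -- diagonals. The tie cannot be settled by the hooks alone, so non-crossing enters as a
    -- hypothesis.
    ≤hook⇒⊀ : h ≤hook h₂ → (content u ≡ content u₂ → row u < row u₂ → content (ω h₂) ℤ.< content (ω h)) → ¬ (u ≺ u₂)
    ≤hook⇒⊀ (inj₁ lt) _ u≺u₂ = ≺⇒¬< u≺u₂ (subst₂ ℤ._<_ αu₂ αu (bottom-content-< a a₂ ¬sa₂ lt))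
      where
      ≺⇒¬< : u ≺ u₂ → ¬ (content u₂ ℤ.< content u)
      ≺⇒¬< (inj₁ p) q = ℤₚ.<-asym p q
      ≺⇒¬< (inj₂ (p , _)) q = ℤₚ.<-irrefl (sym p) q
    ≤hook⇒⊀ (inj₂ (c≡ , r≤)) _ (inj₁ lt) =
      ℤₚ.<-irrefl (trans (sym αu) (trans (bottom-content-≡ a ¬sa a₂ ¬sa₂ c≡) αu₂)) lt
    ≤hook⇒⊀ (inj₂ (c≡ , r≤)) crossing (inj₂ (eq , lt)) = ℤₚ.<⇒≱ (crossing eq lt)
      (content-≤⁺ (ω h) (ω h₂) (ℕₚ.+-mono-≤ (right-end-col-≤ o o₂ ¬eo₂ r≤) r≤))

    ⊀⇒≤hook : ¬ (u ≺ u₂) → (content u ≡ content u₂ → row u₂ ≤ row u → content (ω h) ℤ.≤ content (ω h₂)) → h ≤hook h₂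
    ⊀⇒≤hook ⊀ crossing with ℕₚ.<-cmp (col (α h)) (col (α h₂))
    ... | tri< lt _ _ = ⊥-elim (⊀ (inj₁ (subst₂ ℤ._<_ αu αu₂ (bottom-content-< a₂ a ¬sa lt))))
    ... | tri> _ _ gt = inj₁ gt
    ... | tri≈ _ c≡ _ = inj₂ (c≡ , ℕₚ.≮⇒≥ λ lt → ℤₚ.<⇒≱
            (content-<⁺ (ω h₂) (ω h) (ℕₚ.+-mono-≤-< (right-end-col-≤ o₂ o ¬eo (ℕₚ.<⇒≤ lt)) lt))
            (crossing u≡ (ℕₚ.≮⇒≥ λ lt → ⊀ (inj₂ (u≡ , lt)))))
      where
      u≡ : content u ≡ content u₂
      u≡ = trans (sym αu) (trans (bottom-content-≡ a ¬sa a₂ ¬sa₂ c≡) αu₂)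

  -- Uniqueness

  record First (h : List Cell) (hs : List (List Cell)) (σ : Filling) : Set where
    field
      {u}       : Cell
      {P}       : List Cell
      {τ}       : Filling
      insertion : Insertion (norm τ) (norm σ) u P
      ω≡        : ω (u ∷ P) ≡ ω h
      content≡  : content (α h) ≡ content u
      length≡   : length P ≡ ℓ h
      top       : Top (norm σ) u
      rest      : GoodSeq la τ hs

  hook-content : ∀ {h u P} → IsNEPath la h → IsNEPath la (u ∷ P) → ω (u ∷ P) ≡ ω h → length P ≡ ℓ h →
    content (α h) ≡ content u
  hook-content {_ ∷ _} q p ω≡ len = path-content-cancel q p (sym ω≡) (sym len)

  w-content : ∀ {u v} → In u → In v → content u ≡ content v → content (w u) ≡ content (w v)
  w-content {u} {v} iu iv eq = ℤ-suc-injective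
    (trans (sym (content-w u (proj₁ iu))) (trans eq (content-w v (proj₁ iv))))

  e-w-In : ∀ {u} → In u → In (e (w u))
  e-w-In {_ , suc _} iu = iu

  -- Recursion along the sequence: the next path starts in the greatest candidate of `τ`, and the
  -- order of the hooks keeps that start from being beyond `u`. Whatever is beyond `u` is thus
  -- beyond it too, where `τ` has no candidate.
  first : ∀ h hs {σ} → GoodSeq la σ (h ∷ hs) → First h hs σ
  first h hs {σ} (R ∷ Rs , L , τ , to , (u ∷ P) , p , c , ω≡ , ℓ≡ , rpp , σ≈) = record
    { insertion = I
    ; ω≡ = ω≡
    ; content≡ = content≡
    ; length≡ = ℓ≡
    ; top = insertion-Top I E (beyond hs L Rs to)
    ; rest = Rs , tail L , to
    }
    where
    tail : ∀ {hs} → Linked _≤hook_ (h ∷ hs) → Linked _≤hook_ hs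
    tail [-] = []
    tail (_ ∷ L) = L
    I : Insertion (norm τ) (norm σ) u P
    I = inserts-insertion (InsertsTo-IsRPP hs to) p
          (λ i → proj₁ (proj₂ (proj₂ R)) (subst (λ x → In (e x)) ω≡ i)) c rpp σ≈
    content≡ : content (α h) ≡ content u
    content≡ = hook-content (proj₁ R) p ω≡ ℓ≡
    iα : In (α h)
    iα = α-In (proj₁ R)
    iu : In u
    iu = path-In p (here refl)
    -- A rim-hook begins at the foot of a column, so the diagonal just before it is East; for the
    -- first column this is East in column 0.
    E : East (w u)
    E = East-diag (w-content iα iu content≡) (e-w-In iu) (East-w iα (proj₁ (proj₂ R)))
    beyond : ∀ hs → Linked _≤hook_ (h ∷ hs) → All (IsRimHook la) hs → InsertsTo la hs τ →
      ∀ {v} → In v → East (w v) → u ≺ v → norm τ v ≡ norm τ (w v)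
    beyond [] _ _ zero≈ {v} _ _ _ = trans (vanishes v) (sym (vanishes (w v)))
      where
      vanishes : ∀ v → norm τ v ≡ 0
      vanishes v with In? v
      ... | yes iv = zero≈ v iv
      ... | no _ = refl
    beyond (h₂ ∷ hs) (le ∷ L) (R₂ ∷ Rs) to {v} iv Ev u≺v = Top.beyond F.top iv Ev (≺-of (≺-total F.u v))
      where
      module F = First (first h₂ hs (R₂ ∷ Rs , L , to))
      ⊀ : ¬ (u ≺ F.u)
      ⊀ = ≤hook⇒⊀ R R₂ content≡ F.content≡ le λ eq lt →
            subst₂ ℤ._<_ (cong content F.ω≡) (cong content ω≡) (below-ends-earlier I (insertion-walk F.insertion) eq lt)
      ≺-of : F.u ≺ v ⊎ F.u ≡ v ⊎ v ≺ F.u → F.u ≺ v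
      ≺-of (inj₁ r) = r
      ≺-of (inj₂ (inj₁ refl)) = ⊥-elim (⊀ u≺v)
      ≺-of (inj₂ (inj₂ r)) = ⊥-elim (⊀ (≺-trans u≺v r))

  good-unique : ∀ hs hs′ {σ} → GoodSeq la σ hs → GoodSeq la σ hs′ → hs ≡ hs′
  good-unique [] [] _ _ = refl
  good-unique [] (h ∷ hs) {σ} (_ , _ , zero≈) G = ⊥-elim (zero-no-first zero≈ (first h hs G))
    where
    zero-no-first : σ ≈[ la ] zeroRPP → ¬ First h hs σ
    zero-no-first z F = ℕₚ.<-irrefl (sym (trans (norm-In σ (Top.inside top)) (z _ (Top.inside top))))
      (walk-positive (insertion-walk insertion) (here refl))
      where open First F
  good-unique (h ∷ hs) [] G Z = sym (good-unique [] (h ∷ hs) Z G)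
  good-unique (h ∷ hs) (h′ ∷ hs′) G@(R ∷ _ , _) G′@(R′ ∷ _ , _) = same (first h hs G) (first h′ hs′ G′)
    where
    same : ∀ {σ} → First h hs σ → First h′ hs′ σ → h ∷ hs ≡ h′ ∷ hs′
    same F F′ with Top-unique (First.top F) (First.top F′)
    ... | refl with walk-deterministic (insertion-walk (First.insertion F)) (insertion-walk (First.insertion F′))
    ...   | refl = cong₂ _∷_ (h≡ R R′ (trans F.content≡ (sym F′.content≡)) (trans (sym F.length≡) F′.length≡))
                    (good-unique hs hs′ F.rest (proj₁ F′.rest , proj₁ (proj₂ F′.rest) , InsertsTo-≈ hs′ τ≈ (proj₂ (proj₂ F′.rest))))
      where
      module F = First F
      module F′ = First F′
      module I = Insertion F.insertion
      module I′ = Insertion F′.insertion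
      h≡ : ∀ {h h′} → IsRimHook la h → IsRimHook la h′ → content (α h) ≡ content (α h′) → ℓ h ≡ ℓ h′ → h ≡ h′
      h≡ {_ ∷ _} {_ ∷ _} (p , _ , _ , r) (p′ , _ , _ , r′) c≡ l≡ = rim-path-unique p p′ r r′ c≡ l≡
      -- Both fillings arise from the same one by lowering the same path.
      norm≡ : ∀ v → norm F.τ v ≡ norm F′.τ v
      norm≡ v with v ∈? (F.u ∷ F.P)
      ... | yes v∈ = ℕₚ.suc-injective (trans (sym (I.added v∈)) (I′.added v∈))
      ... | no v∉ = trans (sym (I.kept v∉)) (I′.kept v∉)
      τ≈ : F.τ ≈[ la ] F′.τ
      τ≈ v iv = trans (sym (norm-In F.τ iv)) (trans (norm≡ v) (norm-In F′.τ iv))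

  -- Existence

  -- The witness `x` of `East (w u)` gives the head `e x`: it is on the diagonal of `u`, and
  -- `e (s x)` being outside says that it is the foot of its column.
  rim-hook-exists : ∀ {g u P} → Walk g u P → East (w u) →
    ∃ λ h → IsRimHook la h × ω (u ∷ P) ≡ ω h × length P ≡ ℓ h
  rim-hook-exists {u = i , suc j} {P} W (x , wu↘x , iex , ¬iesx)
    with rim-hook-along W (↘-e wu↘x) iex (λ p → ¬iesx (In-mono p (s≤s z≤n) (s≤s z≤n) ℕₚ.≤-refl (ℕₚ.n≤1+n _)))
  ... | H , p , ωeq , len , rims = (e x ∷ H)
      , (p , ¬iesx , (λ q → walk-end W (subst (λ y → In (e y)) ωeq q)) , rims) , sym ωeq , sym len
  rim-hook-exists {u = i , zero} W _ = ⊥-elim (ℕₚ.<⇒≱ (proj₁ (walk-In W)) z≤n)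

  sum-map-≤ : ∀ {f g : Filling} → (∀ v → f v ≤ g v) → ∀ xs → sum (map f xs) ≤ sum (map g xs)
  sum-map-≤ le [] = z≤n
  sum-map-≤ le (x ∷ xs) = ℕₚ.+-mono-≤ (le x) (sum-map-≤ le xs)

  sum-map-< : ∀ {f g : Filling} {u xs} → (∀ v → f v ≤ g v) → u ∈ xs → f u < g u → sum (map f xs) < sum (map g xs)
  sum-map-< {xs = _ ∷ xs} le (here refl) lt = ℕₚ.+-mono-<-≤ lt (sum-map-≤ le xs)
  sum-map-< le (there u∈) lt = ℕₚ.+-mono-≤-< (le _) (sum-map-< le u∈ lt)

  insertion-good : ∀ {f g u P hs} → Insertion f g u P → Top g u → GoodSeq la f hs → ∃ (GoodSeq la g)
  insertion-good {f} {g} {u} {P} {hs} I T (Rs , L , to)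
    with rim-hook-exists (insertion-walk I) (proj₁ (Top.candidate T))
  ... | h , R , ω≡ , ℓ≡ = h ∷ hs , R ∷ Rs , ordered hs Rs L to
      , f , to , (u ∷ P) , path , insertion-compatible I , ω≡ , ℓ≡
      , IsRPP-≈ (λ v _ → sym (insertion-≡ I v)) (Rpp⇒IsRPP target) , λ v _ → insertion-≡ I v
    where
    open Insertion I
    ordered : ∀ hs → All (IsRimHook la) hs → Linked _≤hook_ hs → InsertsTo la hs f → Linked _≤hook_ (h ∷ hs)
    ordered [] _ _ _ = [-]
    ordered (h₂ ∷ hs) Rs@(R₂ ∷ _) L to = ⊀⇒≤hook R R₂ (hook-content (proj₁ R) path ω≡ ℓ≡) F.content≡ ⊀ crossing ∷ L
      where
      module F = First (first h₂ hs (Rs , L , to))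
      -- `f` already vanishes outside the diagram, so it agrees with `norm f` pointwise; the walk is
      -- carried over along this agreement.
      walk₂ : Walk f F.u F.P
      walk₂ = walk-cong (norm-Rpp-id source) (insertion-walk F.insertion)
      -- Otherwise the start of the next path would be a candidate of `f` beyond `u`, and it would
      -- be one of `g` too, since both its entry and its west neighbour's change together.
      ⊀ : ¬ (u ≺ F.u)
      ⊀ u≺ = ℕₚ.<-irrefl (sym eq) (proj₂ (Top.candidate F.top))
        where
        iu₂ = Top.inside F.top
        E₂ = proj₁ (Top.candidate F.top)
        eq : norm f F.u ≡ norm f (w F.u)
        eq = trans (norm-Rpp-id source _)
               (trans (beyond-source I iu₂ E₂ u≺ (Top.beyond T iu₂ E₂ u≺)) (sym (norm-Rpp-id source _)))
      crossing : content u ≡ content F.u → row F.u ≤ row u → content (ω h) ℤ.≤ content (ω h₂)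
      crossing eq le = subst₂ ℤ._≤_ (cong content ω≡) (cong content F.ω≡) (above-ends-later I walk₂ eq le)

  private
    good-exists′ : ∀ k {g} → Rpp g → size g < k → ∃ (GoodSeq la g)
    good-exists′ (suc k) {g} G (s≤s le) with Top-exists G
    ... | inj₂ zero≈ = [] , [] , [] , λ _ → zero≈
    ... | inj₁ (u , T) with walk-exists G T
    ...   | P , W = insertion-good I T (proj₂ (good-exists′ k source (ℕₚ.<-≤-trans smaller le)))
      where
      I : Insertion (g -P (u ∷ P)) g u P
      I = walk-insertion G W (proj₂ (Top.candidate T))
      open Insertion I
      smaller : size (g -P (u ∷ P)) < size g
      smaller = sum-map-< (λ v → -P-≤ g (u ∷ P) v) (∈-cells (Top.inside T)) (ℕₚ.≤-reflexive (sym (added (here refl))))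

  good-exists : ∀ {g} → Rpp g → ∃ (GoodSeq la g)
  good-exists {g} G = good-exists′ (suc (size g)) G ℕₚ.≤-refl

theorem4 : (la : List ℕ) → IsPartition la → (π : Filling) → IsRPP la π →
    Σ (List (List Cell)) (λ hs → GoodSeq la π hs
    × ((hs′ : List (List Cell)) → GoodSeq la π hs′ → hs′ ≡ hs))
theorem4 la part π R with good-exists la part (norm-Rpp la part R)
... | hs , Rs , L , to = hs , good , λ hs′ good′ → good-unique la part hs′ hs good′ good
  where
  good : GoodSeq la π hs
  good = Rs , L , InsertsTo-≈ la part hs (λ v iv → sym (norm-In la part π iv)) to
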